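{- Let $n\ge1$, let $T$ be a noncrossing tree on the vertex set $[n+1]$, and let $P_n^{\mathcal{S}}$ be a reduced form of the commutative monomial $m^{\mathcal{S}}[T]$. Then $$P_n^{\mathcal{S}}(x_{ij}=1,\ \beta=0)=f_T,$$ where $f_T$ denotes the number of noncrossing alternating spanning trees of $\overline{T}$. If the edges of $T$ are labeled so that $T$ becomes a good tree, then the reduced form $P_n^{\mathcal{B}}$ of the noncommutative monomial $m^{\mathcal{B}}[T]$ satisfies $$P_n^{\mathcal{B}}(x_{ij},\ \beta=0)=\sum_{T_0}x^{T_0},$$ where the sum runs over all noncrossing alternating spanning trees $T_0$ of $\overline{T}$ with lexicographic edge-labels, and $x^{T_0}$ is the noncommutative monomial $\prod_{l=1}^n x_{i_l,j_l}$ if $T_0$ contains the edges $(i_1,j_1)_1,\ldots,(i_n,j_n)_n$.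
   Context: Graphs have vertex set $[n+1]=\{1,\ldots,n+1\}$; an edge joining $i<j$ is written $(i,j)$, and $(i,j)_a$ denotes the edge $(i,j)$ with label $a$. A graph is noncrossing if there are no $i<j<k<l$ with $(i,k),(j,l)$ both edges; alternating if there are no $i<j<k$ with $(i,j),(j,k)$ both edges. The transitive closure $\overline{G}$ has as edges all $(i,j)$ for which there are edges $(i,i_1),(i_1,i_2),\ldots,(i_r,j)$ of $G$ with $i<i_1<\cdots<i_r<j$ (edges of $G$ included). A spanning tree of $\overline{T}$ is a tree with vertex set $[n+1]$ with all edges in $\overline{T}$. Monomials: $m^{\mathcal{S}}[G]=\prod_{(i,j)\in E(G)}x_{ij}$ in commuting variables $x_{ij}$, $1\le i<j\le n+1$. If the edges of $G$ are labeled $1,\ldots,k$ as $(i_1,j_1)_1,\ldots,(i_k,j_k)_k$, then $m^{\mathcal{B}}[G]=x_{i_1j_1}x_{i_2j_2}\cdots x_{i_kj_k}$, a noncommutative monomial. Reductions: the reduction rule is $x_{ij}x_{jk}\to x_{ik}x_{ij}+x_{jk}x_{ik}+\beta x_{ik}$ for $i<j<k$, where $\beta$ is a central variable, applied to a pair of adjacent variables in one monomial of a polynomial at a time. A reduced form in the commutative case is a polynomial obtained from the monomial by successive applications of this rule until no further reduction is possible, where any two variables may be commuted between reductions. In the noncommutative case it is defined the same way, but only variables $x_{ij},x_{kl}$ with $i,j,k,l$ distinct may be commuted between reductions; reduction terminates when no monomial can be reduced even after such commutations. Noncommutative polynomials are considered up to these commutations. A forest $H$ on $[n+1]$ with $k$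 edges labeled $1,\ldots,k$ is good if: (i) if $(i,j)_a,(j,k)_b$ are edges, $i<j<k$, then $a<b$; (ii) if $(i,j)_a,(i,k)_b$ are edges with $i<j<k$, then $a>b$; (iii) if $(i,j)_a,(k,j)_b$ are edges with $i<k<j$, then $a>b$; (iv) $H$ is noncrossing. A good tree is a good forest that is a tree. Lexicographic edge-labels: edge $(i_1,j_1)$ is less than $(i_2,j_2)$ if $j_1>j_2$, or $j_1=j_2$ and $i_1>i_2$. A graph with $k$ edges has lexicographic edge-labels if its edges are labeled $1,\ldots,k$ increasingly with respect to this order. -}

module Defs where

open import Level using (0ℓ)
open import Data.Unit using (⊤)
open import Data.Nat as ℕ using (ℕ; zero; suc; z≤n; s≤s)
open import Data.Nat.ListAction using (sum; product)
import Data.Nat.Properties as ℕ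
open import Data.Fin using (Fin; zero; suc; toℕ; inject; opposite; fromℕ<; _<_; _>_)
open import Data.Fin.Properties as Fin using (_≟_; _<?_; any?; all?)
open import Data.List using (List; []; _∷_; _++_; [_]; map; length;
  lookup; filter; concat; concatMap; replicate; tabulate; allFin; cartesianProduct)
open import Data.List.Properties using (∷-injectiveʳ)
open import Data.List.Membership.Propositional using (_∈_)
import Data.List.Membership.Propositional.Properties as ∈
open import Data.List.Relation.Binary.Sublist.Propositional using (_⊆_; []; _∷_; _∷ʳ_)
open import Data.List.Relation.Unary.All as All using (All; []; _∷_)
import Data.List.Relation.Unary.All.Properties as All
open import Data.List.Relation.Unary.AllPairs as AllPairs using (AllPairs; []; _∷_)
import Data.List.Relation.Unary.AllPairs.Properties as AllPairs
open import Data.List.Relation.Unary.Any as Any using (Any; here; there)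
open import Data.List.Relation.Unary.Linked as Linked using (Linked)
open import Data.List.Relation.Unary.Unique.Propositional using (Unique)
import Data.List.Relation.Unary.Unique.Propositional.Properties as Unique
open import Data.Product using (∃; ∃₂; ∃-syntax; _×_; _,_; proj₁; proj₂; uncurry)
open import Data.Product.Relation.Binary.Pointwise.NonDependent using (×-setoid)
open import Data.Sum using (_⊎_; inj₁; inj₂; [_,_]′)
open import Function using (_∘_; _⇔_; mk⇔)
open import Relation.Binary using (Rel; Setoid; Decidable; Transitive)
open import Relation.Binary.Construct.Closure.Equivalence as Eq using (EqClosure)
open import Relation.Binary.Construct.Closure.ReflexiveTransitive using (Star; ε; _◅_; _◅◅_)
  renaming (map to mapStar)
open import Relation.Binary.Construct.Closure.Transitive using (TransClosure; _∷_)
  renaming ([_] to [_]⁺)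
open import Relation.Binary.PropositionalEquality hiding ([_])
import Data.List.Relation.Binary.Permutation.Setoid as PermutationSetoid
open import Relation.Nullary using (¬_; Dec; ¬?; contradiction; recompute)
open import Relation.Nullary.Decidable using (_×-dec_; _→-dec_; _⊎-dec_; map′)
import Relation.Unary as Unary

private
  variable
    n : ℕ

-- [n+1], numbered from 0.
Vertex : ℕ → Set
Vertex n = Fin (suc n)

record Edge (n : ℕ) : Set where
  constructor edge
  field
    src tgt  : Vertex n
    .src<tgt : src < tgt

open Edge public

-- The edges of a graph, listed in the order of their labels: position a carries
-- the (a+1)-st label.  An unlabeled graph is given by any labeling of it:
-- only LexLabeled, IsGoodForest, IsGoodTree and the word of a monomial depend on the order.
Graph : ℕ → Set
Graph n = List (Edge n)

Arc : Graph n → Rel (Vertex n) 0ℓ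
Arc G i j = Any (λ e → src e ≡ i × tgt e ≡ j) G

Adj : Graph n → Rel (Vertex n) 0ℓ
Adj G u v = Arc G u v ⊎ Arc G v u

Connected : Graph n → Set
Connected G = ∀ u v → Star (Adj G) u v

-- The cycle v — v₁ — ⋯ — vₖ — v, where vs = v₁ ⋯ vₖ.
IsCycle : Graph n → Vertex n → List (Vertex n) → Set
IsCycle G v vs = Unique (v ∷ vs) × 2 ℕ.≤ length vs × Linked (Adj G) (v ∷ vs ++ [ v ])

Acyclic : Graph n → Set
Acyclic G = ¬ (∃₂ λ v vs → IsCycle G v vs)

IsForest : Graph n → Set
IsForest G = Unique G × Acyclic G

IsTree : Graph n → Set
IsTree G = IsForest G × Connected G

Noncrossing : Graph n → Set
Noncrossing G = ∀ i j k l → i < j → j < k → k < l → Arc G i k → ¬ Arc G j l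

Alternating : Graph n → Set
Alternating G = ∀ i j k → Arc G i j → ¬ Arc G j k

-- Arcs go from smaller to larger vertices, so chains of arcs are increasing.
Arc̄ : Graph n → Rel (Vertex n) 0ℓ
Arc̄ G = TransClosure (Arc G)

-- T₀ is a noncrossing alternating spanning tree of the transitive closure of T.
IsNAST : Graph n → Graph n → Set
IsNAST T T₀ =
  IsTree T₀ × All (λ e → Arc̄ T (src e) (tgt e)) T₀ × Noncrossing T₀ × Alternating T₀

infix 4 _≺_

_≺_ : Rel (Edge n) 0ℓ
e ≺ f = tgt e > tgt f ⊎ (tgt e ≡ tgt f × src e > src f)

LexLabeled : Graph n → Set
LexLabeled = AllPairs _≺_

record IsGoodForest (G : Graph n) : Set where
  field
    forest      : IsForest G
    tgt≡src     : ∀ a b → tgt (lookup G a) ≡ src (lookup G b) → a < b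
    src≡src     : ∀ a b → src (lookup G a) ≡ src (lookup G b) →
                  tgt (lookup G a) < tgt (lookup G b) → a > b
    tgt≡tgt     : ∀ a b → tgt (lookup G a) ≡ tgt (lookup G b) →
                  src (lookup G a) < src (lookup G b) → a > b
    noncrossing : Noncrossing G

IsGoodTree : Graph n → Set
IsGoodTree G = IsGoodForest G × IsTree G

-- x_{e₁} ⋯ x_{eₖ} as the list e₁ ⋯ eₖ.
Word : ℕ → Set
Word n = List (Edge n)

-- (b , w) is β^b w.
Term : ℕ → Set
Term n = ℕ × Word n

-- Formal sums of terms; a coefficient c ∈ ℕ is expressed by repeating a term c
-- times.  Reductions never produce other coefficients.
Poly : ℕ → Set
Poly n = List (Term n)

-- For a labeled graph this is the noncommutative monomial.  The commutative
-- one is the same word, read modulo AnyCommute below.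
monomial : Graph n → Term n
monomial G = 0 , G

-- Which pairs of variables may be commuted.
AnyCommute : Rel (Edge n) 0ℓ
AnyCommute _ _ = ⊤

DisjointCommute : Rel (Edge n) 0ℓ
DisjointCommute e f =
  src e ≢ src f × src e ≢ tgt f × tgt e ≢ src f × tgt e ≢ tgt f

module Polynomials (_commutes_ : Rel (Edge n) 0ℓ) where

  data Swap : Rel (Word n) 0ℓ where
    here  : ∀ {e f w} → e commutes f → Swap (e ∷ f ∷ w) (f ∷ e ∷ w)
    there : ∀ {e v w} → Swap v w → Swap (e ∷ v) (e ∷ w)

  infix 4 _∼_ _≈_

  _∼_ : Rel (Word n) 0ℓ
  _∼_ = EqClosure Swap

  termSetoid : Setoid 0ℓ 0ℓ
  termSetoid = ×-setoid (setoid ℕ) (Eq.setoid Swap)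

  _≈_ : Rel (Poly n) 0ℓ
  _≈_ = PermutationSetoid._↭_ termSetoid

  data ReduceTerm : Term n → Poly n → Set where
    reduce : ∀ {b w i j k} u v .(i<j : i < j) .(j<k : j < k) →
      let ij = edge i j i<j
          jk = edge j k j<k
          ik = edge i k (Fin.<-trans i<j j<k)
      in w ∼ u ++ ij ∷ jk ∷ v →
         ReduceTerm (b , w)
           ( (b     , u ++ ik ∷ ij ∷ v)
           ∷ (b     , u ++ jk ∷ ik ∷ v)
           ∷ (suc b , u ++ ik ∷ v)
           ∷ [])

  data Reduce : Rel (Poly n) 0ℓ where
    here  : ∀ {t ts P} → ReduceTerm t ts → Reduce (t ∷ P) (ts ++ P)
    there : ∀ {t P Q} → Reduce P Q → Reduce (t ∷ P) (t ∷ Q)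

  IsReducedForm : Term n → Poly n → Set
  IsReducedForm m P = Star Reduce [ m ] P × ¬ ∃ (Reduce P)

module 𝒮 {n} = Polynomials {n} AnyCommute
module ℬ {n} = Polynomials {n} DisjointCommute

eval : (x : Edge n → ℕ) (β : ℕ) → Poly n → ℕ
eval x β P = sum (map (λ (b , w) → β ℕ.^ b ℕ.* product (map x w)) P)

-- Substitute c for β only.
infixl 8 _[β≔_]

_[β≔_] : Poly n → ℕ → Poly n
P [β≔ c ] = concatMap (λ (b , w) → replicate (c ℕ.^ b) (0 , w)) P

private
  star-list? : ∀ {m} (L : List (Fin m × Fin m)) → Decidable (Star (λ u v → (u , v) ∈ L))
  star-list? []            u v = map′ (λ { refl → ε }) (λ { ε → refl ; (() ◅ _) }) (u ≟ v)
  star-list? {m} (p ∷ L) u v =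
    map′ [ mapStar there , (λ (s , t) → mapStar there s ◅◅ here refl ◅ mapStar there t) ]′ split
      (star-list? L u v ⊎-dec star-list? L u (proj₁ p) ×-dec star-list? L (proj₂ p) v)
    where
    split : ∀ {x y} → Star (λ u v → (u , v) ∈ p ∷ L) x y →
            let R = Star (λ u v → (u , v) ∈ L) in R x y ⊎ (R x (proj₁ p) × R (proj₂ p) y)
    split ε = inj₁ ε
    split (r ◅ s) with r | split s
    ... | here refl | inj₁ t       = inj₂ (ε , t)
    ... | here refl | inj₂ (_ , t) = inj₂ (ε , t)
    ... | there e   | inj₁ t       = inj₁ (e ◅ t)
    ... | there e   | inj₂ (t , t′) = inj₂ (e ◅ t , t′)

  star? : ∀ {m} {R : Rel (Fin m) 0ℓ} → Decidable R → Decidable (Star R)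
  star? {m} {R} R? u v = map′ (mapStar from) (mapStar to) (star-list? L u v)
    where
    pairs = cartesianProduct (allFin m) (allFin m)
    L     = filter (uncurry R?) pairs

    from : ∀ {x y} → (x , y) ∈ L → R x y
    from = proj₂ ∘ ∈.∈-filter⁻ (uncurry R?) {xs = pairs}

    to : ∀ {x y} → R x y → (x , y) ∈ L
    to {x} {y} = ∈.∈-filter⁺ (uncurry R?) (∈.∈-cartesianProduct⁺ (∈.∈-allFin x) (∈.∈-allFin y))

  trans? : ∀ {m} {R : Rel (Fin m) 0ℓ} → Decidable R → Decidable (TransClosure R)
  trans? {R = R} R? u v =
    map′ (λ (_ , r , s) → cons r s) uncons (any? λ w → R? u w ×-dec star? R? w v)
    where
    cons : ∀ {x y z} → R x y → Star R y z → TransClosure R x z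
    cons r ε       = [ r ]⁺
    cons r (s ◅ t) = r ∷ cons s t

    uncons : ∀ {x z} → TransClosure R x z → ∃[ y ] R x y × Star R y z
    uncons [ r ]⁺  = _ , r , ε
    uncons (r ∷ s) = let _ , r′ , t = uncons s in _ , r , r′ ◅ t

  bounded? : ∀ {m} {P : List (Fin m) → Set} → Unary.Decidable P → ∀ k →
             Dec (∃[ xs ] length xs ℕ.≤ k × P xs)
  bounded? P? zero    = map′ (λ p → [] , z≤n , p) (λ { ([] , _ , p) → p }) (P? [])
  bounded? P? (suc k) = map′
    [ (λ p → [] , z≤n , p) , (λ (x , xs , le , p) → x ∷ xs , s≤s le , p) ]′
    (λ { ([] , _ , p) → inj₁ p ; (x ∷ xs , s≤s le , p) → inj₂ (x , xs , le , p) })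
    (P? [] ⊎-dec any? λ x → bounded? (P? ∘ (x ∷_)) k)

  lookup-injective : ∀ {A : Set} {xs : List A} → Unique xs → ∀ {a b} →
                     lookup xs a ≡ lookup xs b → a ≡ b
  lookup-injective {xs = _ ∷ _} (_ ∷ _) {zero}  {zero}  _  = refl
  lookup-injective {xs = _ ∷ xs} (p ∷ _) {zero}  {suc b} eq =
    contradiction eq (All.lookup p (∈.∈-lookup b))
  lookup-injective {xs = _ ∷ xs} (p ∷ _) {suc a} {zero}  eq =
    contradiction (sym eq) (All.lookup p (∈.∈-lookup a))
  lookup-injective {xs = _ ∷ _} (_ ∷ u) {suc a} {suc b} eq = cong suc (lookup-injective u eq)

  unique-length : ∀ {m} {xs : List (Fin m)} → Unique xs → length xs ℕ.≤ m
  unique-length u = Fin.injective⇒≤ (lookup-injective u)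

edge-≡ : {e f : Edge n} → src e ≡ src f → tgt e ≡ tgt f → e ≡ f
edge-≡ refl refl = refl

_≟ᴱ_ : Decidable {A = Edge n} _≡_
e ≟ᴱ f = map′ (uncurry edge-≡) (λ { refl → refl , refl }) (src e ≟ src f ×-dec tgt e ≟ tgt f)

arc? : (G : Graph n) → Decidable (Arc G)
arc? G i j = Any.any? (λ e → src e ≟ i ×-dec tgt e ≟ j) G

adj? : (G : Graph n) → Decidable (Adj G)
adj? G u v = arc? G u v ⊎-dec arc? G v u

isCycle? : (G : Graph n) → ∀ v vs → Dec (IsCycle G v vs)
isCycle? G v vs =
  AllPairs.allPairs? (λ x y → ¬? (x ≟ y)) (v ∷ vs)
  ×-dec 2 ℕ.≤? length vs
  ×-dec Linked.linked? (adj? G) (v ∷ vs ++ [ v ])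

acyclic? : Unary.Decidable (Acyclic {n})
acyclic? {n} G = ¬? (any? λ v → map′
  (λ (vs , _ , c) → vs , c)
  (λ (vs , c) → vs , ℕ.s≤s⁻¹ (unique-length (proj₁ c)) , c)
  (bounded? (isCycle? G v) n))

isTree? : Unary.Decidable (IsTree {n})
isTree? G =
  (AllPairs.allPairs? (λ e f → ¬? (e ≟ᴱ f)) G ×-dec acyclic? G)
  ×-dec all? λ u → all? λ v → star? (adj? G) u v

noncrossing? : Unary.Decidable (Noncrossing {n})
noncrossing? G = all? λ i → all? λ j → all? λ k → all? λ l →
  i <? j →-dec j <? k →-dec k <? l →-dec arc? G i k →-dec ¬? (arc? G j l)

alternating? : Unary.Decidable (Alternating {n})
alternating? G = all? λ i → all? λ j → all? λ k → arc? G i j →-dec ¬? (arc? G j k)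

isNAST? : (T : Graph n) → Unary.Decidable (IsNAST T)
isNAST? T T₀ =
  isTree? T₀
  ×-dec All.all? (λ e → trans? (arc? T) (src e) (tgt e)) T₀
  ×-dec noncrossing? T₀
  ×-dec alternating? T₀

sublists : ∀ {A : Set} → List A → List (List A)
sublists []       = [ [] ]
sublists (x ∷ xs) = map (x ∷_) (sublists xs) ++ sublists xs

private
  inject< : ∀ {m} (i : Fin m) (j : Fin (toℕ i)) → inject j < i
  inject< i j = subst (ℕ._< toℕ i) (sym (Fin.toℕ-inject j)) (Fin.toℕ<n j)

edgeInto : (j : Vertex n) → Fin (toℕ j) → Edge n
edgeInto j a = edge (inject (opposite a)) j (inject< j (opposite a))

-- All edges with target j, by decreasing source.
edgesInto : Vertex n → List (Edge n)
edgesInto j = tabulate (edgeInto j)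

-- All edges, increasing with respect to _≺_.
allEdges : ∀ n → List (Edge n)
allEdges n = concat (tabulate (edgesInto ∘ opposite))

-- Every graph has exactly one lexicographic labeling, so each noncrossing
-- alternating spanning tree is listed exactly once, as its lexicographic labeling.
nasts : Graph n → List (Graph n)
nasts {n} T = filter (isNAST? T) (sublists (allEdges n))

f[_] : Graph n → ℕ
f[ T ] = length (nasts T)

-- Σ x^{T₀}
∑nasts : Graph n → Poly n
∑nasts T = map monomial (nasts T)

private
  opposite-antitone : ∀ {m} {a b : Fin m} → a < b → opposite a > opposite b
  opposite-antitone {m} {a} {b} a<b = subst₂ ℕ._<_
    (sym (Fin.opposite-prop b)) (sym (Fin.opposite-prop a))
    (ℕ.∸-monoʳ-< (s≤s a<b) (Fin.toℕ<n b))

  ≺-irrefl : (e : Edge n) → ¬ e ≺ e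
  ≺-irrefl _ (inj₁ p)       = ℕ.<-irrefl refl p
  ≺-irrefl _ (inj₂ (_ , p)) = ℕ.<-irrefl refl p

  ≺-trans : Transitive (_≺_ {n})
  ≺-trans (inj₁ p)          (inj₁ q)          = inj₁ (ℕ.<-trans q p)
  ≺-trans (inj₁ p)          (inj₂ (refl , _)) = inj₁ p
  ≺-trans (inj₂ (refl , _)) (inj₁ q)          = inj₁ q
  ≺-trans (inj₂ (refl , p)) (inj₂ (refl , q)) = inj₂ (refl , ℕ.<-trans q p)

  edgesInto-sorted : (j : Vertex n) → LexLabeled (edgesInto j)
  edgesInto-sorted j = AllPairs.tabulate⁺-< {f = edgeInto j} λ {a} {b} a<b → inj₂ (refl ,
    subst₂ ℕ._<_ (sym (Fin.toℕ-inject (opposite b))) (sym (Fin.toℕ-inject (opposite a)))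
      (opposite-antitone a<b))

  edgesInto-complete : (e : Edge n) → e ∈ edgesInto (tgt e)
  edgesInto-complete (edge i j i<j) =
    subst (_∈ edgesInto j) (edge-≡ eq refl) (∈.∈-tabulate⁺ {f = edgeInto j} (opposite a))
    where
    lt = recompute (i <? j) i<j
    a  = fromℕ< lt

    eq : inject (opposite (opposite a)) ≡ i
    eq = trans (cong inject (Fin.opposite-involutive a))
      (Fin.toℕ-injective (trans (Fin.toℕ-inject a) (Fin.toℕ-fromℕ< lt)))

  sublists⁺ : ∀ {A : Set} {xs ys : List A} → xs ⊆ ys → xs ∈ sublists ys
  sublists⁺ []         = here refl
  sublists⁺ {ys = _ ∷ ys} (y ∷ʳ s) = ∈.∈-++⁺ʳ (map (y ∷_) (sublists ys)) (sublists⁺ s)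
  sublists⁺ (refl ∷ s) = ∈.∈-++⁺ˡ (∈.∈-map⁺ (_ ∷_) (sublists⁺ s))

  sublists⁻ : ∀ {A : Set} {xs} (ys : List A) → xs ∈ sublists ys → xs ⊆ ys
  sublists⁻ []       (here refl) = []
  sublists⁻ (y ∷ ys) p with ∈.∈-++⁻ (map (y ∷_) (sublists ys)) p
  ... | inj₂ q = y ∷ʳ sublists⁻ ys q
  ... | inj₁ q with _ , r , refl ← ∈.∈-map⁻ (y ∷_) q = refl ∷ sublists⁻ ys r

  ⊆-All : ∀ {A : Set} {P : A → Set} {xs ys} → xs ⊆ ys → All P ys → All P xs
  ⊆-All []         _        = []
  ⊆-All (_ ∷ʳ s)   (_ ∷ ps) = ⊆-All s ps
  ⊆-All (refl ∷ s) (p ∷ ps) = p ∷ ⊆-All s ps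

  ⊆-AllPairs : ∀ {A : Set} {R : Rel A 0ℓ} {xs ys} → xs ⊆ ys → AllPairs R ys → AllPairs R xs
  ⊆-AllPairs []         _        = []
  ⊆-AllPairs (_ ∷ʳ s)   (_ ∷ ps) = ⊆-AllPairs s ps
  ⊆-AllPairs (refl ∷ s) (p ∷ ps) = ⊆-All s p ∷ ⊆-AllPairs s ps

  sorted⇒⊆ : {G H : Graph n} → LexLabeled G → LexLabeled H → (∀ {e} → e ∈ G → e ∈ H) → G ⊆ H
  sorted⇒⊆ {G = []}    {[]}    _ _ _ = []
  sorted⇒⊆ {G = []}    {h ∷ H} s (_ ∷ t) _ = h ∷ʳ sorted⇒⊆ s t λ ()
  sorted⇒⊆ {G = g ∷ G} {[]}    _ _ sub with () ← sub (here refl)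
  sorted⇒⊆ {G = g ∷ G} {h ∷ H} (p ∷ s) (q ∷ t) sub with sub (here refl)
  ... | here refl = refl ∷ sorted⇒⊆ s t λ e∈G → case (sub (there e∈G)) (All.lookup p e∈G)
    where
    case : ∀ {e} → e ∈ h ∷ H → h ≺ e → e ∈ H
    case (here refl) h≺h = contradiction h≺h (≺-irrefl h)
    case (there r)   _   = r
  ... | there g∈H = h ∷ʳ sorted⇒⊆ (p ∷ s) t λ e∈ → case (sub e∈) (h≺ e∈)
    where
    h≺ : ∀ {e} → e ∈ g ∷ G → h ≺ e
    h≺ (here refl) = All.lookup q g∈H
    h≺ {e} (there r)   = ≺-trans {i = h} {g} {e} (All.lookup q g∈H) (All.lookup p r)

    case : ∀ {e} → e ∈ h ∷ H → h ≺ e → e ∈ H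
    case (here refl) h≺h = contradiction h≺h (≺-irrefl h)
    case (there r)   _   = r

  sublists-unique : ∀ {A : Set} {xs : List A} → Unique xs → Unique (sublists xs)
  sublists-unique []      = [] ∷ []
  sublists-unique {xs = x ∷ xs} (p ∷ u) =
    Unique.++⁺ (Unique.map⁺ ∷-injectiveʳ (sublists-unique u)) (sublists-unique u) disjoint
    where
    disjoint : ∀ {ys} → ¬ (ys ∈ map (x ∷_) (sublists xs) × ys ∈ sublists xs)
    disjoint (q , r) with _ , _ , refl ← ∈.∈-map⁻ (x ∷_) q
      with px ∷ _ ← ⊆-All (sublists⁻ xs r) p = px refl

allEdges-sorted : ∀ n → LexLabeled (allEdges n)
allEdges-sorted n = AllPairs.concat⁺
  (All.tabulate⁺ {f = edgesInto ∘ opposite} (edgesInto-sorted ∘ opposite))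
  (AllPairs.tabulate⁺-< {f = edgesInto ∘ opposite} λ {a} {b} a<b →
    All.tabulate⁺ {f = edgeInto (opposite a)} λ _ →
    All.tabulate⁺ {f = edgeInto (opposite b)} λ _ →
    inj₁ (opposite-antitone a<b))

allEdges-complete : (e : Edge n) → e ∈ allEdges n
allEdges-complete e = ∈.∈-concat⁺′ (edgesInto-complete e)
  (subst (λ j → edgesInto j ∈ tabulate (edgesInto ∘ opposite)) (Fin.opposite-involutive (tgt e))
    (∈.∈-tabulate⁺ {f = edgesInto ∘ opposite} (opposite (tgt e))))

private
  ∈-enumeration : {P : Graph n → Set} (P? : Unary.Decidable P) {G : Graph n} →
                  G ∈ filter P? (sublists (allEdges n)) ⇔ (LexLabeled G × P G)
  ∈-enumeration {n} {P} P? {G} = mk⇔ to from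
    where
    to : G ∈ filter P? (sublists (allEdges n)) → LexLabeled G × P G
    to p with q , t ← ∈.∈-filter⁻ P? {xs = sublists (allEdges n)} p =
      ⊆-AllPairs (sublists⁻ (allEdges n) q) (allEdges-sorted n) , t

    from : LexLabeled G × P G → G ∈ filter P? (sublists (allEdges n))
    from (s , t) = ∈.∈-filter⁺ P?
      (sublists⁺ (sorted⇒⊆ s (allEdges-sorted n) λ _ → allEdges-complete _)) t

∈-nasts : (T : Graph n) {T₀ : Graph n} → T₀ ∈ nasts T ⇔ (LexLabeled T₀ × IsNAST T T₀)
∈-nasts T = ∈-enumeration (isNAST? T)

nasts-unique : (T : Graph n) → Unique (nasts T)
nasts-unique {n} T = Unique.filter⁺ (isNAST? T) (sublists-unique
  (AllPairs.map (λ { {e} e≺f refl → ≺-irrefl e e≺f }) (allEdges-sorted n)))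

module Submission where

-- Commutative part.  Modulo β, a reduction subdivides the cone spanned by the
-- vectors e_i − e_j of the edges (i , j) of a graph into two cones.  After
-- deciding for every facet whether it belongs to the cone, the subdivision is a
-- partition, so the number of lattice points with positive coordinates summing
-- to t is additive.  For an alternating graph with n edges this number is a
-- translate of the number of compositions of t into n parts, a polynomial whose
-- leading coefficient depends only on n.  Hence all reductions of a graph have
-- the same number of leaves, and it remains to exhibit one with f_T leaves.
--
-- If (i , j) and (j , k) are the longest edges of a noncrossing tree T that
-- enter and leave j, then both reducts T₁ and T₂ are noncrossing trees, and the
-- noncrossing alternating spanning trees of the closure of T are those of the
-- closure of T₁ together with those of the closure of T₂: an edge outside the
-- closure of T₁ and one outside the closure of T₂ cross or violate alternation.
--
-- Noncommutative part.  In a good tree, (i , j) and (j , k) can be made adjacent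
-- exactly for such longest pairs, reductions preserve goodness, and irreducible
-- good trees are alternating, with the lexicographic labeling up to commutations.

open import Defs
open import Level using (0ℓ)
import Algebra.Properties.CommutativeMonoid.Sum
open import Data.Bool using (Bool; true; false; not; _∧_; if_then_else_)
open import Data.Bool.Properties using (∧-zeroʳ; T-≡)
open import Data.Fin using (Fin; zero; suc; toℕ; _<_; _≤_)
open import Data.Fin.Properties as Fin using (_≟_; _<?_; any?; toℕ≤pred[n])
open import Data.List using (List; []; _∷_; _++_; [_]; map; length; filter; allFin; concatMap; lookup)
open import Data.List.Membership.Propositional using (_∈_; find)
import Data.List.Membership.Propositional.Properties as ∈
open import Data.List.Membership.Propositional.Properties.WithK using (unique∧set⇒bag)
open import Data.List.Properties using (filter-all; filter-≐; length-tabulate; length-++; length-map; map-++; map-∘; map-id; ++-assoc; ++-identityʳ)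
open import Data.List.Relation.Binary.BagAndSetEquality using (∼bag⇒↭)
open import Data.List.Relation.Binary.Permutation.Propositional as ↭ using (_↭_; ↭-sym; ↭-trans)
import Data.List.Relation.Binary.Permutation.Propositional.Properties as ↭
import Data.List.Relation.Binary.Permutation.Setoid as PermutationSetoid
open import Data.List.Relation.Binary.Pointwise as Pointwise using (Pointwise; []; _∷_)
open import Data.List.Relation.Unary.All as All using (All; []; _∷_)
import Data.List.Relation.Unary.All.Properties as All
open import Data.List.Relation.Unary.AllPairs as AllPairs using (AllPairs; []; _∷_)
import Data.List.Relation.Unary.AllPairs.Properties as AllPairs
open import Data.List.Relation.Unary.Any as Any using (Any; here; there)
import Data.List.Relation.Unary.Any.Properties as AnyP
open import Data.List.Relation.Unary.Linked as Linked using (Linked; [-]; _∷_)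
open import Data.List.Relation.Unary.Unique.Propositional using (Unique)
import Data.List.Relation.Unary.Unique.Propositional.Properties as Unique
open import Data.Nat as ℕ using (ℕ; zero; suc; z≤n; s≤s; _+_; _*_; _∸_; _≡ᵇ_; _≤ᵇ_)
open import Data.Nat.Induction using (<-wellFounded)
open import Data.Nat.ListAction using (product) renaming (sum to sumᴸ)
import Data.Nat.ListAction.Properties as ListAction
import Data.Nat.Properties as ℕ
open import Data.Nat.Solver using (module +-*-Solver)
open import Data.Product using (∃; ∃-syntax; _×_; _,_; proj₁; proj₂)
open import Data.Sum as Sum using (_⊎_; inj₁; inj₂)
open import Data.Unit using (tt)
open import Function using (_∘_; id; mk⇔; Equivalence)
open import Induction.WellFounded using (Acc; acc)
open import Relation.Binary using (Rel; Setoid; tri<; tri≈; tri>)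
import Relation.Binary.Construct.Closure.Equivalence as Eq
open import Relation.Binary.Construct.Closure.ReflexiveTransitive as Star using (Star; ε; _◅_; _◅◅_; _⋆)
open import Relation.Binary.Construct.Closure.Symmetric using (fwd; bwd)
open import Relation.Binary.Construct.Closure.Transitive using (_∷_) renaming ([_] to [_]⁺)
open import Relation.Binary.PropositionalEquality hiding ([_])
open import Relation.Nullary using (¬_; Dec; yes; no; does; ¬?; contradiction; recompute)
open import Relation.Nullary.Decidable using (_×-dec_; dec-false)
open import Relation.Unary using (Decidable)

open Algebra.Properties.CommutativeMonoid.Sum ℕ.+-0-commutativeMonoid
  using (sum; sum-cong-≗; ∑-distrib-+; sum-replicate-zero)
open +-*-Solver using (solve; _:+_; _:*_; _:=_)

private
  variable
    n : ℕ
    G H : Graph n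
    e f : Edge n
    u v : Vertex n
    φ ψ : ℕ → ℕ

-- Connected graphs and trees

src<tgt′ : (e : Edge n) → src e < tgt e
src<tgt′ (edge i j i<j) = recompute (i <? j) i<j

arc⁺ : e ∈ G → Arc G (src e) (tgt e)
arc⁺ = Any.map λ { refl → refl , refl }

arc⁻ : Arc G u v → ∃[ e ] e ∈ G × src e ≡ u × tgt e ≡ v
arc⁻ = find

arc-< : Arc G u v → u < v
arc-< a with e , _ , refl , refl ← arc⁻ a = src<tgt′ e

∈-arc : Arc G (src e) (tgt e) → e ∈ G
∈-arc a with f , f∈ , p , q ← arc⁻ a = subst (_∈ _) (edge-≡ p q) f∈

adj-sym : Adj G u v → Adj G v u
adj-sym = Sum.swap

arc-mono : (∀ {e} → e ∈ G → e ∈ H) → Arc G u v → Arc H u v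
arc-mono G⊆H a with e , e∈ , refl , refl ← arc⁻ a = arc⁺ (G⊆H e∈)

adj-mono : (∀ {e} → e ∈ G → e ∈ H) → Adj G u v → Adj H u v
adj-mono G⊆H = Sum.map (arc-mono G⊆H) (arc-mono G⊆H)

walk-sym : Star (Adj G) u v → Star (Adj G) v u
walk-sym {G = G} = Star.reverse (adj-sym {G = G})

connected-by : (∀ {e} → e ∈ G → Star (Adj H) (src e) (tgt e)) → Connected G → Connected H
connected-by {G = G} {H = H} walk conn u v = (step ⋆) (conn u v)
  where
  step : ∀ {x y} → Adj G x y → Star (Adj H) x y
  step (inj₁ a) with _ , e∈ , refl , refl ← arc⁻ a = walk e∈
  step (inj₂ a) with _ , e∈ , refl , refl ← arc⁻ a = walk-sym {G = H} (walk e∈)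

∈⇒↭ : ∀ {A : Set} {x : A} {xs} → x ∈ xs → ∃[ ys ] xs ↭ x ∷ ys
∈⇒↭ x∈ with ys , zs , refl ← ∈.∈-∃++ x∈ = ys ++ zs , ↭.shift _ ys zs

module _ {A : Set} {x : A} (≢x? : (y : A) → Dec (y ≢ x)) where

  length-remove : {xs : List A} → Unique xs → length xs ℕ.≤ suc (length (filter ≢x? xs))
  length-remove [] = z≤n
  length-remove {y ∷ xs} (p ∷ u) with ≢x? y
  ... | yes _ = s≤s (length-remove u)
  ... | no ¬y≢x = s≤s (ℕ.≤-reflexive (cong length (sym (filter-all ≢x?
          (All.map (λ y≢z z≡x → ¬y≢x λ y≡x → y≢z (trans y≡x (sym z≡x))) p)))))

-- A union-find function: the vertices of a component share one representative. Adding `e` redirects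
-- the component of `src e` to the representative of `tgt e`.
rep : Graph n → Vertex n → Vertex n
rep []      u = u
rep (e ∷ G) u with rep G u ≟ rep G (src e)
... | yes _ = rep G (tgt e)
... | no  _ = rep G u

rep-≢ : ∀ e (G : Graph n) u → rep G u ≢ rep G (src e) → rep (e ∷ G) u ≡ rep G u
rep-≢ e G u ne with rep G u ≟ rep G (src e)
... | yes eq = contradiction eq ne
... | no _ = refl

rep-cong : ∀ e (G : Graph n) u v → rep G u ≡ rep G v → rep (e ∷ G) u ≡ rep (e ∷ G) v
rep-cong e G u v eq with rep G u ≟ rep G (src e) | rep G v ≟ rep G (src e)
... | yes _ | yes _ = refl
... | yes p | no ¬p = contradiction (trans (sym eq) p) ¬p
... | no ¬p | yes p = contradiction (trans eq p) ¬p
... | no _  | no _  = eq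

rep-edge : (G : Graph n) → e ∈ G → rep G (src e) ≡ rep G (tgt e)
rep-edge (e ∷ G) (here refl) with rep G (src e) ≟ rep G (src e) | rep G (tgt e) ≟ rep G (src e)
... | yes _ | yes _ = refl
... | yes _ | no _  = refl
... | no ¬p | _     = contradiction refl ¬p
rep-edge (f ∷ G) (there e∈) = rep-cong f G _ _ (rep-edge G e∈)

rep-walk : (G : Graph n) → Star (Adj G) u v → rep G u ≡ rep G v
rep-walk G ε = refl
rep-walk G (inj₁ a ◅ s) with e , e∈ , refl , refl ← arc⁻ a = trans (rep-edge G e∈) (rep-walk G s)
rep-walk G (inj₂ a ◅ s) with e , e∈ , refl , refl ← arc⁻ a = trans (sym (rep-edge G e∈)) (rep-walk G s)

weaken : Star (Adj G) u v → Star (Adj (e ∷ G)) u v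
weaken {G = G} {e = e} = Star.map (adj-mono {G = G} {H = e ∷ G} there)

-- With `rep-walk`: two vertices have equal representatives exactly when a walk joins them.
walk-rep : (G : Graph n) (u : Vertex n) → Star (Adj G) u (rep G u)
walk-rep []      u = ε
walk-rep (e ∷ G) u with rep G u ≟ rep G (src e)
... | no _  = weaken {G = G} (walk-rep G u)
... | yes p =
  weaken {G = G} (subst (Star _ u) p (walk-rep G u) ◅◅ walk-sym {G = G} (walk-rep G (src e)))
  ◅◅ inj₁ (here (refl , refl)) ◅ weaken {G = G} (walk-rep G (tgt e))

-- Adding `e` changes `rep` only on the class of `src e`, whose only possible fixed point is
-- `rep G (src e)`. So each edge destroys at most one of the n + 1 fixed points of the empty graph.
fixed-points : (G : Graph n) →
  ∃[ us ] Unique us × All (λ u → rep G u ≡ u) us × suc n ℕ.≤ length us ℕ.+ length G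
fixed-points {n} [] = allFin (suc n) , Unique.allFin⁺ (suc n) , All.tabulate (λ _ → refl) ,
  ℕ.≤-reflexive (trans (sym (length-tabulate {n = suc n} id)) (sym (ℕ.+-identityʳ _)))
fixed-points (e ∷ G) with us , uniq , fixed , le ← fixed-points G =
  us′ , Unique.filter⁺ ≢r? uniq , All.tabulate fixed′ ,
  ℕ.≤-trans le (ℕ.≤-trans (ℕ.+-monoˡ-≤ (length G) (length-remove ≢r? uniq))
    (ℕ.≤-reflexive (sym (ℕ.+-suc _ _))))
  where
  ≢r? = λ u → ¬? (u ≟ rep G (src e))
  us′ = filter ≢r? us
  fixed′ : ∀ {u} → u ∈ us′ → rep (e ∷ G) u ≡ u
  fixed′ {u} u∈ with q , ne ← ∈.∈-filter⁻ ≢r? {xs = us} u∈ =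
    let eq = All.lookup fixed q in trans (rep-≢ e G u (ne ∘ trans (sym eq))) eq

connected⇒≤length : (G : Graph n) → Connected G → n ℕ.≤ length G
connected⇒≤length {n} G conn with fixed-points G
... | [] , _ , _ , le = ℕ.≤-trans (ℕ.n≤1+n n) le
... | _ ∷ [] , _ , _ , s≤s le = le
-- Fixed points joined by a walk coincide, so a connected graph has at most one.
... | u ∷ v ∷ _ , (u≢v ∷ _) ∷ _ , p ∷ q ∷ _ , _ =
  contradiction (trans (sym p) (trans (rep-walk G (conn u v)) q)) u≢v

-- The end `v` is listed first so that an edge between `v` and `u` closes the path, if `ws` is
-- nonempty, to a cycle in the form of `IsCycle`.
SimplePath : Graph n → Vertex n → Vertex n → Set
SimplePath G u v = ∃[ ws ] Unique (v ∷ u ∷ ws) × Linked (Adj G) (u ∷ ws ++ [ v ])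

simple-suffix : ∀ {G : Graph n} {xs} → u ∈ xs → Unique (v ∷ xs) → Linked (Adj G) (xs ++ [ v ]) →
                SimplePath G u v
simple-suffix (here refl) uniq link = _ , uniq , link
simple-suffix {xs = _ ∷ _ ∷ _} (there u∈) ((_ ∷ p) ∷ (_ ∷ q)) (_ ∷ link) = simple-suffix u∈ (p ∷ q) link

-- Loop erasure: if the new vertex already lies on the simple path found for the remaining walk, the
-- path is cut back to start there.
simplify : u ≢ v → Star (Adj G) u v → SimplePath G u v
simplify u≢v ε = contradiction refl u≢v
simplify {v = v} u≢v (_◅_ {j = w} a s) with w ≟ v
... | yes refl = [] , ((u≢v ∘ sym) ∷ []) ∷ [] ∷ [] , a ∷ [-]
... | no w≢v with ws , p@(q ∷ r) , link ← simplify w≢v s | Any.any? (_ ≟_) (w ∷ ws)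
...   | yes u∈ = simple-suffix u∈ p link
...   | no u∉ = w ∷ ws , ((u≢v ∘ sym) ∷ q) ∷ All.¬Any⇒All¬ _ u∉ ∷ r , a ∷ link

acyclic-tail : Acyclic (e ∷ G) → Acyclic G
acyclic-tail {e = e} {G = G} ac (v , vs , uniq , le , link) =
  ac (v , vs , uniq , le , Linked.map (adj-mono {G = G} {H = e ∷ G} there) link)

-- A walk in `G` between the ends of `e` would yield a simple path. With inner vertices it closes to
-- a cycle; without, it is a single edge, which would be a second copy of `e` or point backwards.
forest-rep : Unique (e ∷ G) → Acyclic (e ∷ G) → rep G (src e) ≢ rep G (tgt e)
forest-rep {e = e} {G = G} (e∉ ∷ _) ac eq
  with simplify (Fin.<⇒≢ (src<tgt′ e))
         (subst (Star _ (src e)) eq (walk-rep G (src e)) ◅◅ walk-sym {G = G} (walk-rep G (tgt e)))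
... | [] , _ , inj₁ a ∷ _ = All.lookup e∉ (∈-arc a) refl
... | [] , _ , inj₂ a ∷ _ = Fin.<-asym (src<tgt′ e) (arc-< a)
... | w ∷ ws , uniq , link =
  ac (tgt e , src e ∷ w ∷ ws , uniq , s≤s (s≤s z≤n) ,
      inj₂ (here (refl , refl)) ∷ Linked.map (adj-mono {G = G} {H = e ∷ G} there) link)

-- The counterpart of `fixed-points`: in a forest each edge joins two components, so every edge uses
-- up a representative. As at least one is left, there are at most n edges.
representatives : (G : Graph n) → IsForest G →
  ∃[ us ] (∀ u → rep G u ∈ us) × length us ℕ.+ length G ℕ.≤ suc n
representatives {n} [] _ = allFin (suc n) , ∈.∈-allFin ,
  ℕ.≤-reflexive (trans (ℕ.+-identityʳ _) (length-tabulate {n = suc n} id))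
representatives (e ∷ G) (uniq@(_ ∷ uniq′) , ac)
  with us , covers , le ← representatives G (uniq′ , acyclic-tail {G = G} ac)
  with us′ , perm ← ∈⇒↭ (covers (src e)) =
  us′ , covers′ , ℕ.≤-trans (ℕ.≤-reflexive (trans (ℕ.+-suc _ _)
    (cong (ℕ._+ length G) (sym (↭.↭-length perm))))) le
  where
  other : ∀ {x} → x ∈ us → x ≢ rep G (src e) → x ∈ us′
  other x∈ ne with ↭.∈-resp-↭ perm x∈
  ... | here eq = contradiction eq ne
  ... | there p = p

  covers′ : ∀ u → rep (e ∷ G) u ∈ us′
  covers′ u with rep G u ≟ rep G (src e)
  ... | yes _ = other (covers (tgt e)) (forest-rep uniq ac ∘ sym)
  ... | no ne = other (covers u) ne

tree-length : {G : Graph n} → IsTree G → length G ≡ n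
tree-length {n} {G} (forest , conn) = ℕ.≤-antisym upper (connected⇒≤length G conn)
  where
  upper : length G ℕ.≤ n
  upper with representatives G forest
  ... | [] , covers , _ with () ← covers zero
  ... | _ ∷ us , _ , s≤s le = ℕ.≤-trans (ℕ.m≤n+m _ (length us)) le

-- Otherwise `G′` would still be connected, with only n - 1 edges.
bridge : {G G′ : Graph n} → Connected G → length G ≡ n → G ↭ e ∷ G′ →
         ¬ Star (Adj G′) (src e) (tgt e)
bridge {n} {e = e} {G} {G′} conn len perm s =
  ℕ.1+n≰n (subst (ℕ._≤ length G′) (trans (sym len) (↭.↭-length perm))
    (connected⇒≤length G′ (connected-by {G = G} {H = G′} (λ e∈ → walk (↭.∈-resp-↭ perm e∈)) conn)))
  where
  walk : ∀ {f} → f ∈ e ∷ G′ → Star (Adj G′) (src f) (tgt f)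
  walk (here refl) = s
  walk (there f∈)  = inj₁ (arc⁺ f∈) ◅ ε

module _ {G G′ : Graph n} {e : Edge n} (perm : G ↭ e ∷ G′) where

  avoid-arc : ∀ {x y} → x ≢ src e ⊎ y ≢ tgt e → Arc G x y → Arc G′ x y
  avoid-arc ne a with f , f∈ , refl , refl ← arc⁻ a with ↭.∈-resp-↭ perm f∈ | ne
  ... | here refl | inj₁ x≢ = contradiction refl x≢
  ... | here refl | inj₂ y≢ = contradiction refl y≢
  ... | there f∈′ | _       = arc⁺ f∈′

  avoid-adj : ∀ {x y} → x ≢ src e ⊎ y ≢ tgt e → x ≢ tgt e ⊎ y ≢ src e → Adj G x y → Adj G′ x y
  avoid-adj p q (inj₁ a) = inj₁ (avoid-arc p a)
  avoid-adj p q (inj₂ a) = inj₂ (avoid-arc (Sum.swap q) a)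

  avoid-path : ∀ {v} x xs → All (λ y → y ≢ src e × y ≢ tgt e) (x ∷ xs) →
               Linked (Adj G) (x ∷ xs ++ [ v ]) → Star (Adj G′) x v
  avoid-path x []       ((p , q) ∷ _)  (a ∷ _)    = avoid-adj (inj₁ p) (inj₁ q) a ◅ ε
  avoid-path x (y ∷ ys) ((p , q) ∷ ps) (a ∷ link) =
    avoid-adj (inj₁ p) (inj₁ q) a ◅ avoid-path y ys ps link

-- The rest of a cycle joins the ends of its first edge, against `bridge`.
connected⇒acyclic : {G : Graph n} → Connected G → length G ≡ n → Acyclic G
connected⇒acyclic conn len (v , [] , _ , () , _)
connected⇒acyclic conn len (v , _ ∷ [] , _ , s≤s () , _)
connected⇒acyclic {n} {G} conn len (v , w ∷ x ∷ xs , p@(_ ∷ v≢x ∷ _) ∷ q@(w≢x ∷ _) ∷ _ , _ , a ∷ b ∷ link)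
  with a
... | inj₁ a with e , e∈ , refl , refl ← arc⁻ a with G′ , perm ← ∈⇒↭ e∈ =
  bridge conn len perm (walk-sym {G = G′}
    (avoid-adj perm (inj₂ (w≢x ∘ sym)) (inj₂ (v≢x ∘ sym)) b
     ◅ avoid-path perm x xs (All.zipWith (λ (f , g) → f ∘ sym , g ∘ sym) (All.tail p , q)) link))
... | inj₂ a with e , e∈ , refl , refl ← arc⁻ a with G′ , perm ← ∈⇒↭ e∈ =
  bridge conn len perm
    (avoid-adj perm (inj₂ (v≢x ∘ sym)) (inj₂ (w≢x ∘ sym)) b
     ◅ avoid-path perm x xs (All.zipWith (λ (f , g) → g ∘ sym , f ∘ sym) (All.tail p , q)) link)

-- Reductions of noncrossing trees

-- Trees are described by connectedness and the number of edges, which are easy to follow through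
-- reductions; `connected⇒acyclic` recovers acyclicity.
record NoncrossingTree (G : Graph n) : Set where
  field
    noncrossing : Noncrossing G
    connected   : Connected G
    edges       : length G ≡ n

noncrossing-mono : (∀ {e} → e ∈ G → e ∈ H) → Noncrossing H → Noncrossing G
noncrossing-mono G⊆H nc i j k l p q r a b = nc i j k l p q r (arc-mono G⊆H a) (arc-mono G⊆H b)

connected-mono : (∀ {e} → e ∈ G → e ∈ H) → Connected G → Connected H
connected-mono {G = G} {H = H} G⊆H conn u v = Star.map (adj-mono {G = G} {H = H} G⊆H) (conn u v)

NoncrossingTree-resp-↭ : G ↭ H → NoncrossingTree G → NoncrossingTree H
NoncrossingTree-resp-↭ p t = record
  { noncrossing = noncrossing-mono (↭.∈-resp-↭ (↭-sym p)) noncrossing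
  ; connected   = connected-mono (↭.∈-resp-↭ p) connected
  ; edges       = trans (sym (↭.↭-length p)) edges
  } where open NoncrossingTree t

closure-< : Arc̄ G u v → u < v
closure-< [ a ]⁺  = arc-< a
closure-< (a ∷ s) = Fin.<-trans (arc-< a) (closure-< s)

closure⇒walk : Arc̄ G u v → Star (Arc G) u v
closure⇒walk [ a ]⁺  = a ◅ ε
closure⇒walk (a ∷ s) = a ◅ closure⇒walk s

≤-walk : Star (Arc G) u v → u ≤ v
≤-walk ε       = ℕ.≤-refl
≤-walk (a ◅ s) = ℕ.≤-trans (ℕ.<⇒≤ (arc-< a)) (≤-walk s)

walk⇒closure : u < v → Star (Arc G) u v → Arc̄ G u v
walk⇒closure u<v ε = contradiction refl (Fin.<⇒≢ u<v)
walk⇒closure u<v (a ◅ ε) = [ a ]⁺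
walk⇒closure u<v (a ◅ b ◅ s) =
  a ∷ walk⇒closure (ℕ.<-≤-trans (arc-< b) (≤-walk s)) (b ◅ s)

-- The two walks are the parts before the first and after the last use of `e`.
split-walk : Star (Arc (e ∷ G)) u v → Star (Arc G) u v ⊎ (Star (Arc G) u (src e) × Star (Arc G) (tgt e) v)
split-walk ε = inj₁ ε
split-walk (a ◅ s) with a | split-walk s
... | here (refl , refl) | inj₁ t       = inj₂ (ε , t)
... | here (refl , refl) | inj₂ (_ , t) = inj₂ (ε , t)
... | there a            | inj₁ t       = inj₁ (a ◅ t)
... | there a            | inj₂ (t , t′) = inj₂ (a ◅ t , t′)

undirected : Star (Arc G) u v → Star (Adj G) u v
undirected = Star.map inj₁

nasts-cong : (G H : Graph n) → (∀ {T₀} → IsNAST G T₀ → IsNAST H T₀) →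
             (∀ {T₀} → IsNAST H T₀ → IsNAST G T₀) → nasts G ≡ nasts H
nasts-cong {n} G H to from =
  filter-≐ (isNAST? G) (isNAST? H) (to , from) (sublists (allEdges n))

IsNAST-mono : (∀ {e} → e ∈ G → Arc̄ H (src e) (tgt e)) → ∀ {T₀} → IsNAST G T₀ → IsNAST H T₀
IsNAST-mono {G = G} {H = H} G⊆H (tree , arcs , rest) =
  tree , All.map (λ {e} a → walk⇒closure (src<tgt′ e) ((step ⋆) (closure⇒walk a))) arcs , rest
  where
  step : ∀ {x y} → Arc G x y → Star (Arc H) x y
  step a with _ , e∈ , refl , refl ← arc⁻ a = closure⇒walk (G⊆H e∈)

nasts-↭ : G ↭ H → nasts G ≡ nasts H
nasts-↭ {G = G} {H} p = nasts-cong G H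
  (IsNAST-mono (λ e∈ → [ arc⁺ (↭.∈-resp-↭ p e∈) ]⁺))
  (IsNAST-mono (λ e∈ → [ arc⁺ (↭.∈-resp-↭ (↭-sym p) e∈) ]⁺))

f-↭ : G ↭ H → f[ G ] ≡ f[ H ]
f-↭ p = cong length (nasts-↭ p)

filter-⊎ : ∀ {A : Set} {P Q R : A → Set} (P? : Decidable P) (Q? : Decidable Q) (R? : Decidable R) →
           (∀ {x} → P x → Q x ⊎ R x) → (∀ {x} → Q x → P x) → (∀ {x} → R x → P x) →
           (∀ {x} → Q x → ¬ R x) →
           ∀ xs → filter P? xs ↭ filter Q? xs ++ filter R? xs
filter-⊎ P? Q? R? split Q⇒P R⇒P ¬QR [] = ↭.refl
filter-⊎ P? Q? R? split Q⇒P R⇒P ¬QR (x ∷ xs)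
  with ih ← filter-⊎ P? Q? R? split Q⇒P R⇒P ¬QR xs | P? x | Q? x | R? x
... | _     | yes q | yes r = contradiction r (¬QR q)
... | yes _ | yes _ | no _  = ↭.prep x ih
... | yes _ | no _  | yes _ = ↭-trans (↭.prep x ih) (↭-sym (↭.shift x (filter Q? xs) (filter R? xs)))
... | yes p | no ¬q | no ¬r with split p
...   | inj₁ q = contradiction q ¬q
...   | inj₂ r = contradiction r ¬r
filter-⊎ P? Q? R? split Q⇒P R⇒P ¬QR (x ∷ xs) | no ¬p | yes q | _ = contradiction (Q⇒P q) ¬p
filter-⊎ P? Q? R? split Q⇒P R⇒P ¬QR (x ∷ xs) | no ¬p | _ | yes r = contradiction (R⇒P r) ¬p
filter-⊎ P? Q? R? split Q⇒P R⇒P ¬QR (x ∷ xs) | no ¬p | no _ | no _ = ih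

-- The reduction at (i , j) and (j , k) keeps trees noncrossing if these are
-- the longest edges entering and leaving j.
module NoncrossingReduction {n} (i j k : Vertex n) .(i<j : i < j) .(j<k : j < k) (R : Graph n) where

  ij jk ik : Edge n
  ij = edge i j i<j
  jk = edge j k j<k
  ik = edge i k (Fin.<-trans i<j j<k)

  T T₁ T₂ : Graph n
  T  = ij ∷ jk ∷ R
  T₁ = ik ∷ ij ∷ R
  T₂ = jk ∷ ik ∷ R

  module _ (tree : NoncrossingTree T)
           (i-min : ∀ {m} → Arc T m j → i ≤ m) (k-max : ∀ {l} → Arc T j l → l ≤ k) where

    open NoncrossingTree tree

    private
      i<′j = src<tgt′ ij
      j<′k = src<tgt′ jk
      i<′k = src<tgt′ ik

      aij : Arc T i j
      aij = here (refl , refl)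

      ajk : Arc T j k
      ajk = there (here (refl , refl))

      -- Comparing the end inside (i , k) with j: an arc crossing (i , k) crosses (i , j) or (j ,
      -- k), or it is an edge at j that is longer than the longest one.
      ik-crosses-not : ∀ {a b} → Arc T a b → ¬ (a < i × i < b × b < k) × ¬ (i < a × a < k × k < b)
      ik-crosses-not {a} {b} ab = left , right
        where
        left : ¬ (a < i × i < b × b < k)
        left (a<i , i<b , b<k) with Fin.<-cmp b j
        ... | tri< b<j _ _  = noncrossing a i b j a<i i<b b<j ab aij
        ... | tri≈ _ refl _ = ℕ.<⇒≱ a<i (i-min ab)
        ... | tri> _ _ j<b  = noncrossing a j b k (Fin.<-trans a<i i<′j) j<b b<k ab ajk

        right : ¬ (i < a × a < k × k < b)
        right (i<a , a<k , k<b) with Fin.<-cmp a j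
        ... | tri< a<j _ _  = noncrossing i a j b i<a a<j (Fin.<-trans j<′k k<b) aij ab
        ... | tri≈ _ refl _ = ℕ.<⇒≱ k<b (k-max ab)
        ... | tri> _ _ j<a  = noncrossing j a k b j<a a<k k<b ajk ab

      add-ik : ∀ {G} → (∀ {e} → e ∈ G → e ≡ ik ⊎ e ∈ T) → Noncrossing G
      add-ik {G} sub a b c d a<b b<c c<d ac bd
        with e , e∈ , refl , refl ← arc⁻ ac | f , f∈ , refl , refl ← arc⁻ bd
        with sub e∈ | sub f∈
      ... | inj₁ refl | inj₁ refl = Fin.<-irrefl refl a<b
      ... | inj₁ refl | inj₂ f∈T  = proj₂ (ik-crosses-not (arc⁺ f∈T)) (a<b , b<c , c<d)
      ... | inj₂ e∈T  | inj₁ refl = proj₁ (ik-crosses-not (arc⁺ e∈T)) (a<b , b<c , c<d)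
      ... | inj₂ e∈T  | inj₂ f∈T  = noncrossing _ _ _ _ a<b b<c c<d (arc⁺ e∈T) (arc⁺ f∈T)

    tree₁ : NoncrossingTree T₁
    tree₁ = record
      { noncrossing = add-ik λ { (here p) → inj₁ p ; (there (here p)) → inj₂ (here p)
                               ; (there (there p)) → inj₂ (there (there p)) }
      ; connected   = connected-by {G = T} {H = T₁} walk connected
      ; edges       = edges }
      where
      walk : ∀ {e} → e ∈ T → Star (Adj T₁) (src e) (tgt e)
      walk (here refl)         = inj₁ (there (here (refl , refl))) ◅ ε
      walk (there (here refl)) = inj₂ (there (here (refl , refl))) ◅ inj₁ (here (refl , refl)) ◅ ε
      walk (there (there e∈))  = inj₁ (there (there (arc⁺ e∈))) ◅ ε

    tree₂ : NoncrossingTree T₂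
    tree₂ = record
      { noncrossing = add-ik λ { (here p) → inj₂ (there (here p)) ; (there (here p)) → inj₁ p
                               ; (there (there p)) → inj₂ (there (there p)) }
      ; connected   = connected-by {G = T} {H = T₂} walk connected
      ; edges       = edges }
      where
      walk : ∀ {e} → e ∈ T → Star (Adj T₂) (src e) (tgt e)
      walk (here refl)         = inj₁ (there (here (refl , refl))) ◅ inj₂ (here (refl , refl)) ◅ ε
      walk (there (here refl)) = inj₁ (here (refl , refl)) ◅ ε
      walk (there (there e∈))  = inj₁ (there (there (arc⁺ e∈))) ◅ ε

    private
      T⇒jk∷ : ∀ {u v} → Arc T u v → Arc (jk ∷ ij ∷ R) u v
      T⇒jk∷ (here p)          = there (here p)
      T⇒jk∷ (there (here p))  = here p
      T⇒jk∷ (there (there a)) = there (there a)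

      T₁⇒ij∷ : ∀ {u v} → Arc T₁ u v → Arc (ij ∷ ik ∷ R) u v
      T₁⇒ij∷ (here p)          = there (here p)
      T₁⇒ij∷ (there (here p))  = here p
      T₁⇒ij∷ (there (there a)) = there (there a)

      ij∷⇒T : ∀ {u v} → Arc (ij ∷ R) u v → Arc T u v
      ij∷⇒T (here p)  = here p
      ij∷⇒T (there a) = there (there a)

      to₂ : ∀ {u v} → Arc (jk ∷ R) u v → Arc T₂ u v
      to₂ (here p)  = here p
      to₂ (there a) = there (there a)

      -- Walks cannot jump over i into (i , j], nor from [j , k) over k.
      through-i : ∀ {a} → Star (Arc T) a j → a ≤ i → Star (Arc T) a i
      through-i ε j≤i = contradiction j≤i (ℕ.<⇒≱ i<′j)
      through-i {a} (_◅_ {j = b} ab s) a≤i with a ≟ i | Fin.<-cmp i b | Fin.<-cmp b j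
      ... | yes refl | _            | _            = ε
      ... | no _     | tri> _ _ b<i | _            = ab ◅ through-i s (ℕ.<⇒≤ b<i)
      ... | no _     | tri≈ _ refl _ | _           = ab ◅ ε
      ... | no a≢i   | tri< i<b _ _ | tri< b<j _ _ =
        contradiction aij (noncrossing a i b j (Fin.≤∧≢⇒< a≤i a≢i) i<b b<j ab)
      ... | no a≢i   | tri< _ _ _   | tri≈ _ refl _ =
        contradiction (i-min ab) (ℕ.<⇒≱ (Fin.≤∧≢⇒< a≤i a≢i))
      ... | no _     | tri< _ _ _   | tri> _ _ j<b = contradiction (≤-walk s) (ℕ.<⇒≱ j<b)

      through-k : ∀ {a b} → Star (Arc T) a b → j ≤ a → a ≤ k → k ≤ b → Star (Arc T) k b
      through-k ε _ a≤k k≤a = subst (Star _ _) (Fin.≤-antisym k≤a a≤k) ε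
      through-k {a} (_◅_ {j = c} ac s) j≤a a≤k k≤b with a ≟ k | Fin.<-cmp c k | a ≟ j
      ... | yes refl | _             | _        = ac ◅ s
      ... | no _     | tri< c<k _ _  | _        =
        through-k s (ℕ.<⇒≤ (ℕ.≤-<-trans j≤a (arc-< ac))) (ℕ.<⇒≤ c<k) k≤b
      ... | no _     | tri≈ _ refl _ | _        = s
      ... | no _     | tri> _ _ k<c  | yes refl = contradiction (k-max ac) (ℕ.<⇒≱ k<c)
      ... | no a≢k   | tri> _ _ k<c  | no a≢j   = contradiction ac
        (noncrossing j a k c (Fin.≤∧≢⇒< j≤a (a≢j ∘ sym)) (Fin.≤∧≢⇒< a≤k a≢k) k<c ajk)

      stay₁ : ∀ {a b} → Star (Arc T) a b → ¬ (a ≤ j × k ≤ b) → Star (Arc T₁) a b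
      stay₁ s ¬p with split-walk (Star.map T⇒jk∷ s)
      ... | inj₁ t       = Star.map there t
      ... | inj₂ (t , t′) = contradiction (≤-walk t , ≤-walk t′) ¬p

      stay₂ : ∀ {a b} → Star (Arc T) a b → ¬ (a ≤ i × j ≤ b) → Star (Arc T₂) a b
      stay₂ s ¬p with split-walk s
      ... | inj₁ t       = Star.map to₂ t
      ... | inj₂ (t , t′) = contradiction (≤-walk t , ≤-walk t′) ¬p

      -- Only walks using `jk` are affected. If such a walk starts at or before i, it passes through
      -- i and can take `ik` instead. In `closure₂`, walks using `ij` and ending at or after k pass
      -- through k.
      closure₁ : ∀ {a b} → Arc̄ T a b → Arc̄ T₁ a b ⊎ (i < a × a ≤ j × k ≤ b)
      closure₁ {a} {b} p with split-walk (Star.map T⇒jk∷ (closure⇒walk p))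
      ... | inj₁ t = inj₁ (walk⇒closure (closure-< p) (Star.map there t))
      ... | inj₂ (t , t′) with i <? a
      ...   | yes i<a = inj₂ (i<a , ≤-walk t , ≤-walk t′)
      ...   | no i≮a = inj₁ (walk⇒closure (closure-< p)
              (stay₁ (through-i (Star.map ij∷⇒T t) (ℕ.≮⇒≥ i≮a)) (λ (_ , k≤i) → ℕ.<⇒≱ i<′k k≤i)
               ◅◅ here (refl , refl) ◅
               stay₁ (Star.map ij∷⇒T t′) (λ (k≤j , _) → ℕ.<⇒≱ j<′k k≤j)))

      closure₂ : ∀ {a b} → Arc̄ T a b → Arc̄ T₂ a b ⊎ (a ≤ i × j ≤ b × b < k)
      closure₂ {a} {b} p with split-walk (closure⇒walk p)
      ... | inj₁ t = inj₁ (walk⇒closure (closure-< p) (Star.map to₂ t))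
      ... | inj₂ (t , t′) with b <? k
      ...   | yes b<k = inj₂ (≤-walk t , ≤-walk t′ , b<k)
      ...   | no b≮k = inj₁ (walk⇒closure (closure-< p)
              (stay₂ (Star.map there t) (λ (_ , j≤i) → ℕ.<⇒≱ i<′j j≤i)
               ◅◅ there (here (refl , refl)) ◅
               stay₂ (through-k (Star.map there t′) ℕ.≤-refl (ℕ.<⇒≤ j<′k) (ℕ.≮⇒≥ b≮k))
                 (λ (k≤i , _) → ℕ.<⇒≱ i<′k k≤i)))

      sum-All : ∀ {A : Set} {P Q : A → Set} {xs} → All (λ x → P x ⊎ Q x) xs → All P xs ⊎ Any Q xs
      sum-All [] = inj₁ []
      sum-All (inj₂ q ∷ _) = inj₂ (here q)
      sum-All (inj₁ p ∷ s) with sum-All s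
      ... | inj₁ ps = inj₁ (p ∷ ps)
      ... | inj₂ qs = inj₂ (there qs)

      -- An edge (c , d) outside the first closure and an edge (a , b) outside the second satisfy a
      -- ≤ i < c ≤ j ≤ b < k ≤ d. They cross, or c = b and alternation fails.
      split : ∀ {T₀} → IsNAST T T₀ → IsNAST T₁ T₀ ⊎ IsNAST T₂ T₀
      split (tree₀ , arcs , nc , alt) with sum-All (All.map closure₁ arcs)
      ... | inj₁ arcs₁ = inj₁ (tree₀ , arcs₁ , nc , alt)
      ... | inj₂ any₁ with sum-All (All.map closure₂ arcs)
      ...   | inj₁ arcs₂ = inj₂ (tree₀ , arcs₂ , nc , alt)
      ...   | inj₂ any₂
        with f , f∈ , i<c , c≤j , k≤d ← find any₁ | e , e∈ , a≤i , j≤b , b<k ← find any₂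
        with src f ≟ tgt e
      ... | yes c≡b = contradiction (arc⁺ f∈) (alt _ _ _ (subst (Arc _ _) (sym c≡b) (arc⁺ e∈)))
      ... | no c≢b = contradiction (arc⁺ f∈) (nc _ _ _ _ (ℕ.≤-<-trans a≤i i<c)
              (Fin.≤∧≢⇒< (ℕ.≤-trans c≤j j≤b) c≢b) (ℕ.<-≤-trans b<k k≤d) (arc⁺ e∈))

      sub₁ : ∀ {e} → e ∈ T₁ → Arc̄ T (src e) (tgt e)
      sub₁ (here refl)         = aij ∷ [ ajk ]⁺
      sub₁ (there (here refl)) = [ aij ]⁺
      sub₁ (there (there e∈))  = [ there (there (arc⁺ e∈)) ]⁺

      sub₂ : ∀ {e} → e ∈ T₂ → Arc̄ T (src e) (tgt e)
      sub₂ (here refl)         = [ ajk ]⁺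
      sub₂ (there (here refl)) = aij ∷ [ ajk ]⁺
      sub₂ (there (there e∈))  = [ there (there (arc⁺ e∈)) ]⁺

      -- An arc a → b of both closures joins a and b inside ik ∷ R: if its walks
      -- use ij in T₁ and jk in T₂, they contribute walks j → b and a → j.
      both : ∀ {a b} → Arc̄ T₁ a b → Arc̄ T₂ a b → Star (Adj (ik ∷ R)) a b
      both p q with split-walk (Star.map T₁⇒ij∷ (closure⇒walk p)) | split-walk (closure⇒walk q)
      ... | inj₁ t       | _            = undirected {G = ik ∷ R} t
      ... | inj₂ _       | inj₁ t       = undirected {G = ik ∷ R} t
      ... | inj₂ (_ , t) | inj₂ (s , _) = undirected {G = ik ∷ R} (s ◅◅ t)

      -- A spanning tree in both closures would make `ik ∷ R` connected, which has only n - 1 edges.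
      exclusive : ∀ {T₀} → IsNAST T₁ T₀ → ¬ IsNAST T₂ T₀
      exclusive {T₀} ((_ , conn₀) , arcs₁ , _) (_ , arcs₂ , _) = ℕ.1+n≰n
        (subst (ℕ._≤ length (ik ∷ R)) (sym edges)
          (connected⇒≤length (ik ∷ R) (connected-by {G = T₀} {H = ik ∷ R}
            (λ e∈ → both (All.lookup arcs₁ e∈) (All.lookup arcs₂ e∈)) conn₀)))

    nasts-reduce : nasts T ↭ nasts T₁ ++ nasts T₂
    nasts-reduce = filter-⊎ (isNAST? T) (isNAST? T₁) (isNAST? T₂) split
      (IsNAST-mono sub₁) (IsNAST-mono sub₂) exclusive (sublists (allEdges n))

    f-reduce : f[ T ] ≡ f[ T₁ ] + f[ T₂ ]
    f-reduce = trans (↭.↭-length nasts-reduce) (length-++ (nasts T₁) {nasts T₂})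

-- Alternating noncrossing trees

lex-irrefl : ¬ e ≺ e
lex-irrefl (inj₁ p)       = ℕ.<-irrefl refl p
lex-irrefl (inj₂ (_ , p)) = ℕ.<-irrefl refl p

lex-asym : ∀ {e f : Edge n} → e ≺ f → ¬ f ≺ e
lex-asym (inj₁ p)       (inj₁ q)       = ℕ.<-asym p q
lex-asym (inj₁ p)       (inj₂ (q , _)) = Fin.<⇒≢ p q
lex-asym (inj₂ (p , _)) (inj₁ q)       = Fin.<⇒≢ q p
lex-asym (inj₂ (_ , p)) (inj₂ (_ , q)) = ℕ.<-asym p q

lex-unique : LexLabeled G → Unique G
lex-unique = AllPairs.map λ { {e} e≺f refl → lex-irrefl {e = e} e≺f }

lex-tail : ∀ {g : Edge n} → All (g ≺_) G → (∀ {e} → e ∈ g ∷ G → e ∈ g ∷ H) → ∀ {e} → e ∈ G → e ∈ H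
lex-tail {g = g} p sub e∈ with sub (there e∈)
... | here refl = contradiction (All.lookup p e∈) (lex-irrefl {e = g})
... | there e∈H = e∈H

lex-≡ : {G H : Graph n} → LexLabeled G → LexLabeled H →
        (∀ {e} → e ∈ G → e ∈ H) → (∀ {e} → e ∈ H → e ∈ G) → G ≡ H
lex-≡ {G = []}    {[]}    _ _ _ _ = refl
lex-≡ {G = []}    {_ ∷ _} _ _ _ ⊇ with () ← ⊇ (here refl)
lex-≡ {G = _ ∷ _} {[]}    _ _ ⊆ _ with () ← ⊆ (here refl)
lex-≡ {G = g ∷ G} {h ∷ H} (p ∷ s) (q ∷ t) ⊆ ⊇ with ⊆ (here refl) | ⊇ (here refl)
... | there g∈H | there h∈G =
  contradiction (All.lookup p h∈G) (lex-asym {e = h} {g} (All.lookup q g∈H))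
... | here refl | _         = cong (g ∷_) (lex-≡ s t (lex-tail p ⊆) (lex-tail q ⊇))
... | there _   | here refl = cong (g ∷_) (lex-≡ s t (lex-tail p ⊆) (lex-tail q ⊇))

_∈?_ : (e : Edge n) (G : Graph n) → Dec (e ∈ G)
e ∈? G = Any.any? (e ≟ᴱ_) G

lexsort : Graph n → Graph n
lexsort {n} G = filter (_∈? G) (allEdges n)

lexsort-sorted : (G : Graph n) → LexLabeled (lexsort G)
lexsort-sorted {n} G = AllPairs.filter⁺ (_∈? G) (allEdges-sorted n)

∈-lexsort⁺ : e ∈ G → e ∈ lexsort G
∈-lexsort⁺ {e = e} {G = G} e∈ = ∈.∈-filter⁺ (_∈? G) (allEdges-complete e) e∈

∈-lexsort⁻ : e ∈ lexsort G → e ∈ G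
∈-lexsort⁻ {G = G} e∈ = proj₂ (∈.∈-filter⁻ (_∈? G) {xs = allEdges _} e∈)

unique-length-≤ : ∀ {A : Set} {xs ys : List A} → Unique xs → (∀ {x} → x ∈ xs → x ∈ ys) →
                  length xs ℕ.≤ length ys
unique-length-≤ [] _ = z≤n
unique-length-≤ (p ∷ u) sub with ys′ , perm ← ∈⇒↭ (sub (here refl)) =
  ℕ.≤-trans (s≤s (unique-length-≤ u sub′)) (ℕ.≤-reflexive (sym (↭.↭-length perm)))
  where
  sub′ : ∀ {x} → x ∈ _ → x ∈ ys′
  sub′ x∈ with ↭.∈-resp-↭ perm (sub (there x∈))
  ... | here refl = contradiction refl (All.lookup p x∈)
  ... | there x∈′ = x∈′

singleton : ∀ {A : Set} {x : A} {xs} → Unique xs → x ∈ xs → (∀ {y} → y ∈ xs → y ≡ x) → xs ≡ [ x ]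
singleton {xs = y ∷ []}    _ _ all = cong [_] (all (here refl))
singleton {xs = y ∷ z ∷ _} ((y≢z ∷ _) ∷ _) _ all =
  contradiction (trans (all (here refl)) (sym (all (there (here refl))))) y≢z

alternating-closure : Alternating G → Arc̄ G u v → Arc G u v
alternating-closure alt [ a ]⁺        = a
alternating-closure alt (a ∷ [ b ]⁺)  = contradiction b (alt _ _ _ a)
alternating-closure alt (a ∷ (b ∷ _)) = contradiction b (alt _ _ _ a)

-- The closure of an alternating graph adds no edges, so a spanning tree of it is a subset of `G`.
-- By `bridge` it cannot omit an edge.
nasts-alternating : NoncrossingTree G → Alternating G → nasts G ≡ [ lexsort G ]
nasts-alternating {n} {G} tree alt =
  singleton (nasts-unique G) (Equivalence.from (∈-nasts G) (lexsort-sorted G , nast)) unique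
  where
  open NoncrossingTree tree

  S : Graph n
  S = lexsort G

  S-connected : Connected S
  S-connected = connected-mono {H = S} ∈-lexsort⁺ connected

  S-edges : length S ≡ n
  S-edges = ℕ.≤-antisym
    (subst (length S ℕ.≤_) edges (unique-length-≤ (lex-unique (lexsort-sorted G)) (∈-lexsort⁻ {G = G})))
    (connected⇒≤length S S-connected)

  nast : IsNAST G S
  nast = ((lex-unique (lexsort-sorted G) , connected⇒acyclic S-connected S-edges) , S-connected) ,
    All.tabulate (λ e∈ → [ arc⁺ (∈-lexsort⁻ {G = G} e∈) ]⁺) ,
    noncrossing-mono (∈-lexsort⁻ {G = G}) noncrossing ,
    λ i j k a b → alt i j k (arc-mono (∈-lexsort⁻ {G = G}) a) (arc-mono (∈-lexsort⁻ {G = G}) b)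

  unique : ∀ {T₀} → T₀ ∈ nasts G → T₀ ≡ S
  unique {T₀} T₀∈ with sorted , (_ , conn₀) , arcs , _ ← Equivalence.to (∈-nasts G) T₀∈ =
    lex-≡ sorted (lexsort-sorted G) (∈-lexsort⁺ {G = G} ∘ T₀⊆G) (G⊆T₀ ∘ ∈-lexsort⁻ {G = G})
    where
    T₀⊆G : ∀ {e} → e ∈ T₀ → e ∈ G
    T₀⊆G e∈ = ∈-arc (alternating-closure alt (All.lookup arcs e∈))

    G⊆T₀ : ∀ {e} → e ∈ G → e ∈ T₀
    G⊆T₀ {e} e∈ with e ∈? T₀
    ... | yes p = p
    ... | no e∉ with G′ , perm ← ∈⇒↭ e∈ =
      contradiction (Star.map (adj-mono {G = T₀} {H = G′} T₀⊆G′) (conn₀ _ _)) (bridge connected edges perm)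
      where
      T₀⊆G′ : ∀ {f} → f ∈ T₀ → f ∈ G′
      T₀⊆G′ f∈ with ↭.∈-resp-↭ perm (T₀⊆G f∈)
      ... | here refl = contradiction f∈ e∉
      ... | there p   = p

f-alternating : NoncrossingTree G → Alternating G → f[ G ] ≡ 1
f-alternating tree alt = cong length (nasts-alternating tree alt)

minimum : ∀ {m} {P : Fin m → Set} → Decidable P → ∃ P → ∃[ x ] P x × (∀ {y} → P y → x ≤ y)
minimum {suc _} P? (x , p) with P? zero
... | yes p₀ = zero , p₀ , λ _ → z≤n
minimum {suc _} P? (zero , p)  | no ¬p₀ = contradiction p ¬p₀
minimum {suc _} P? (suc x , p) | no ¬p₀ with y , q , least ← minimum (P? ∘ suc) (x , p) =
  suc y , q , λ { {zero} p₀ → contradiction p₀ ¬p₀ ; {suc _} r → s≤s (least r) }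

maximum : ∀ {m} {P : Fin m → Set} → Decidable P → ∃ P → ∃[ x ] P x × (∀ {y} → P y → y ≤ x)
maximum {suc _} P? (x , p) with any? (P? ∘ suc)
... | yes q with y , q , greatest ← maximum (P? ∘ suc) q =
  suc y , q , λ { {zero} _ → z≤n ; {suc _} r → s≤s (greatest r) }
maximum {suc _} P? (zero , p)  | no ¬q = zero , p , λ { {zero} _ → z≤n ; {suc _} r → contradiction (_ , r) ¬q }
maximum {suc _} P? (suc x , p) | no ¬q = contradiction (x , p) ¬q

record LongestPair (G : Graph n) : Set where
  field
    i j k : Vertex n
    ij    : Arc G i j
    jk    : Arc G j k
    i-min : ∀ {m} → Arc G m j → i ≤ m
    k-max : ∀ {l} → Arc G j l → l ≤ k

alternating-or-pair : (G : Graph n) → Alternating G ⊎ LongestPair G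
alternating-or-pair G with any? (λ j → any? (λ i → arc? G i j) ×-dec any? (arc? G j))
... | no ¬p = inj₁ λ i j k a b → ¬p (j , (i , a) , (k , b))
... | yes (j , in-j , out-j)
  with i , a , i-min ← minimum (λ i → arc? G i j) in-j | k , b , k-max ← maximum (arc? G j) out-j =
  inj₂ record { ij = a ; jk = b ; i-min = i-min ; k-max = k-max }

extract-pair : ∀ {i j k : Vertex n} .(i<j : i < j) .(j<k : j < k) → Arc G i j → Arc G j k →
               ∃[ R ] G ↭ edge i j i<j ∷ edge j k j<k ∷ R
extract-pair i<j j<k a b with G′ , perm ← ∈⇒↭ (∈-arc {e = edge _ _ i<j} a)
  with ↭.∈-resp-↭ perm (∈-arc {e = edge _ _ j<k} b)
... | here refl = contradiction (arc-< a) (ℕ.<-irrefl refl)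
... | there f∈ with R , perm′ ← ∈⇒↭ f∈ = R , ↭-trans perm (↭.prep _ perm′)

-- Reductions of words

-- The words of the terms free of β, which are those that survive β = 0.
zeros : Poly n → List (Word n)
zeros []                = []
zeros ((zero  , w) ∷ P) = w ∷ zeros P
zeros ((suc _ , _) ∷ P) = zeros P

[β≔0]-zeros : (P : Poly n) → P [β≔ 0 ] ≡ map monomial (zeros P)
[β≔0]-zeros []                = refl
[β≔0]-zeros ((zero  , w) ∷ P) = cong ((0 , w) ∷_) ([β≔0]-zeros P)
[β≔0]-zeros ((suc _ , _) ∷ P) = [β≔0]-zeros P

module Words {n} (_commutes_ : Rel (Edge n) 0ℓ) where
  open Polynomials _commutes_

  ∼⇒↭ : ∀ {v w} → v ∼ w → v ↭ w
  ∼⇒↭ = Eq.fold ↭.↭-isEquivalence swap⇒↭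
    where
    swap⇒↭ : ∀ {v w} → Swap v w → v ↭ w
    swap⇒↭ (here _)  = ↭.swap _ _ ↭.refl
    swap⇒↭ (there s) = ↭.prep _ (swap⇒↭ s)

  ∼-cons : ∀ e {v w} → v ∼ w → e ∷ v ∼ e ∷ w
  ∼-cons e = Eq.gmap (e ∷_) there

  ∼-++ : ∀ u {v w} → v ∼ w → u ++ v ∼ u ++ w
  ∼-++ []      s = s
  ∼-++ (e ∷ u) s = ∼-cons e (∼-++ u s)

  ∼-sym : ∀ {v w} → v ∼ w → w ∼ v
  ∼-sym = Eq.symmetric Swap

  ∼-move : ∀ {e} u {w} → All (e commutes_) u → e ∷ u ++ w ∼ u ++ e ∷ w
  ∼-move []      []       = ε
  ∼-move (f ∷ u) (c ∷ cs) = Eq.return (here c) ◅◅ ∼-cons f (∼-move u cs)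

  ∼-partition : ∀ {P : Edge n → Set} (P? : Decidable P) u {w} →
                (∀ {e f} → P e → f ∈ u → ¬ P f → e commutes f) →
                u ++ w ∼ filter (¬? ∘ P?) u ++ filter P? u ++ w
  ∼-partition P? [] comm = ε
  ∼-partition P? (e ∷ u) comm with ih ← ∼-cons e (∼-partition P? u λ p → comm p ∘ there) | P? e
  ... | no _  = ih
  ... | yes p = ih ◅◅ ∼-move (filter (¬? ∘ P?) u) (All.tabulate λ f∈ →
    let f∈u , ¬p = ∈.∈-filter⁻ (¬? ∘ P?) {xs = u} f∈ in comm p (there f∈u) ¬p)

  -- Reductions modulo β; stop is what a reduction of a multiple of β becomes.
  data _↦_ (w : Word n) : List (Word n) → Set where
    reduce : ∀ u v {i j k} .(i<j : i < j) .(j<k : j < k) →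
      let ij = edge i j i<j
          jk = edge j k j<k
          ik = edge i k (Fin.<-trans i<j j<k)
      in w ∼ u ++ ij ∷ jk ∷ v → w ↦ ((u ++ ik ∷ ij ∷ v) ∷ (u ++ jk ∷ ik ∷ v) ∷ [])

  data _⟶_ : Rel (List (Word n)) 0ℓ where
    stop : ∀ {ws} → ws ⟶ ws
    here  : ∀ {w vs ws} → w ↦ vs → (w ∷ ws) ⟶ (vs ++ ws)
    there : ∀ {w vs ws} → vs ⟶ ws → (w ∷ vs) ⟶ (w ∷ ws)

  -- Exponents of β never decrease, so multiples of β have no descendants in `zeros`, and the third
  -- term of the rule drops out.
  reduce-zeros : ∀ {P Q} → Reduce P Q → zeros P ⟶ zeros Q
  reduce-zeros (here {t = zero  , w} (reduce u v i<j j<k s)) = here (reduce u v i<j j<k s)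
  reduce-zeros (here {t = suc _ , w} (reduce u v i<j j<k s)) = stop
  reduce-zeros (there {t = zero  , _} r) = there (reduce-zeros r)
  reduce-zeros (there {t = suc _ , _} r) = reduce-zeros r

  irreducible-zeros : ∀ P → ¬ ∃ (Reduce P) → All (λ w → ¬ ∃ (w ↦_)) (zeros P)
  irreducible-zeros []                irr = []
  irreducible-zeros ((zero  , w) ∷ P) irr =
    (λ { (_ , reduce u v i<j j<k s) → irr (_ , here (reduce u v i<j j<k s)) })
    ∷ irreducible-zeros P (λ (_ , r) → irr (_ , there r))
  irreducible-zeros ((suc _ , w) ∷ P) irr = irreducible-zeros P (λ (_ , r) → irr (_ , there r))


-- Good words and their reductions

-- Conditions (i)–(iii) of good forests for an edge e with a smaller label than f.
Before : Rel (Edge n) 0ℓ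
Before e f = tgt f ≢ src e × (src e ≡ src f → tgt f < tgt e) × (tgt e ≡ tgt f → src f < src e)

-- Conditions on labels become conditions on pairs of entries, which split along concatenations.
record GoodWord (w : Word n) : Set where
  field
    tree    : NoncrossingTree w
    ordered : AllPairs Before w

disjoint-sym : (e f : Edge n) → DisjointCommute e f → DisjointCommute f e
disjoint-sym _ _ (p , q , r , s) = p ∘ sym , r ∘ sym , q ∘ sym , s ∘ sym

disjoint⇒before : (e f : Edge n) → DisjointCommute e f → Before e f
disjoint⇒before _ _ (p , q , r , s) = q ∘ sym , (λ eq → contradiction eq p) , (λ eq → contradiction eq s)

before-irrefl : (e : Edge n) → ¬ Before e e
before-irrefl _ (_ , p , _) = ℕ.<-irrefl refl (p refl)

module _ {n : ℕ} where
  open ℬ {n} using (Swap; here; there; _∼_)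
  open Words {n} DisjointCommute

  -- Disjoint edges satisfy `Before` in either order.
  swap-ordered : {v w : Word n} → Swap v w → AllPairs Before v → AllPairs Before w
  swap-ordered (here {e} {f} d) ((_ ∷ p) ∷ q ∷ o) = (disjoint⇒before f e (disjoint-sym e f d) ∷ q) ∷ p ∷ o
  swap-ordered (there {v = v} s) (p ∷ o) =
    ↭.All-resp-↭ (∼⇒↭ (Eq.return s)) p ∷ swap-ordered s o

  swap-sym : {v w : Word n} → Swap v w → Swap w v
  swap-sym (here {e} {f} d) = here (disjoint-sym e f d)
  swap-sym (there s) = there (swap-sym s)

  ∼-ordered : {v w : Word n} → v ∼ w → AllPairs Before v → AllPairs Before w
  ∼-ordered ε o = o
  ∼-ordered (fwd s ◅ t) o = ∼-ordered t (swap-ordered s o)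
  ∼-ordered (bwd s ◅ t) o = ∼-ordered t (swap-ordered (swap-sym s) o)

  ∼-good : {v w : Word n} → v ∼ w → GoodWord v → GoodWord w
  ∼-good s g = record
    { tree    = NoncrossingTree-resp-↭ (∼⇒↭ s) (GoodWord.tree g)
    ; ordered = ∼-ordered s (GoodWord.ordered g) }

allPairs-++⁻ : ∀ {A : Set} {R : Rel A 0ℓ} xs {ys} → AllPairs R (xs ++ ys) →
               AllPairs R xs × AllPairs R ys × All (λ x → All (R x) ys) xs
allPairs-++⁻ []       ps       = [] , ps , []
allPairs-++⁻ (x ∷ xs) (p ∷ ps) =
  let q , r , s = allPairs-++⁻ xs ps in All.++⁻ˡ xs p ∷ q , r , All.++⁻ʳ xs p ∷ s

module GoodReduction {n} (u v : Word n) {i j k : Vertex n} .(i<j : i < j) .(j<k : j < k)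
  (good : GoodWord (u ++ edge i j i<j ∷ edge j k j<k ∷ v)) where

  module N = NoncrossingReduction i j k i<j j<k (u ++ v)
  open N using (ij; jk; ik; T)
  open GoodWord good

  private
    shift₂ : ∀ e f → u ++ e ∷ f ∷ v ↭ e ∷ f ∷ u ++ v
    shift₂ e f = ↭.shifts u (e ∷ f ∷ [])

    treeT : NoncrossingTree T
    treeT = NoncrossingTree-resp-↭ (shift₂ ij jk) tree

    open NoncrossingTree treeT

    i<′j = src<tgt′ ij
    j<′k = src<tgt′ jk
    i<′k = src<tgt′ ik

    before-uv : AllPairs Before u
    before-uv = proj₁ (allPairs-++⁻ u ordered)

    before-u : All (λ e → All (Before e) (ij ∷ jk ∷ v)) u
    before-u = proj₂ (proj₂ (allPairs-++⁻ u ordered))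

    before-rest : AllPairs Before (ij ∷ jk ∷ v)
    before-rest = proj₁ (proj₂ (allPairs-++⁻ u ordered))

    aij : Arc T i j
    aij = here (refl , refl)

    ajk : Arc T j k
    ajk = there (here (refl , refl))

    -- As `ij` and `jk` are adjacent, every other edge comes before both or after both.
    data Position (e : Edge n) : Set where
      is-ij  : e ≡ ij → Position e
      is-jk  : e ≡ jk → Position e
      before : e ∈ u → Before e ij → Before e jk → Position e
      after  : e ∈ v → Before ij e → Before jk e → Position e

    position : e ∈ T → Position e
    position (here p)         = is-ij p
    position (there (here p)) = is-jk p
    position (there (there p)) with ∈.∈-++⁻ u p | before-rest
    ... | inj₁ e∈u | _ with p ∷ q ∷ _ ← All.lookup before-u e∈u = before e∈u p q
    ... | inj₂ e∈v | (_ ∷ p) ∷ q ∷ _ = after e∈v (All.lookup p e∈v) (All.lookup q e∈v)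

    -- An edge (m , j) after `jk` violates (i); if it comes before `ij`, then (iii) gives i < m.
    -- Dually, `k-max` uses (i) against `ij` and (ii) against `jk`.
    i-min : ∀ {m} → Arc T m j → i ≤ m
    i-min a with e , e∈ , refl , eq ← arc⁻ a with position e∈
    ... | is-ij refl                 = ℕ.≤-refl
    ... | is-jk refl                 = contradiction eq (Fin.<⇒≢ j<′k ∘ sym)
    ... | before _ (_ , _ , p) _     = ℕ.<⇒≤ (p eq)
    ... | after _ _ (p , _)          = contradiction eq p

    k-max : ∀ {l} → Arc T j l → l ≤ k
    k-max a with e , e∈ , eq , refl ← arc⁻ a with position e∈
    ... | is-ij refl                 = contradiction eq (Fin.<⇒≢ i<′j)
    ... | is-jk refl                 = ℕ.≤-refl
    ... | before _ (p , _) _         = contradiction (sym eq) p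
    ... | after _ _ (_ , p , _)      = ℕ.<⇒≤ (p (sym eq))

    ik∉T : ¬ ik ∈ T
    ik∉T ik∈ with G′ , perm ← ∈⇒↭ ik∈ = bridge connected edges perm
      (inj₁ (avoid-arc perm (inj₂ (Fin.<⇒≢ j<′k)) aij)
       ◅ inj₁ (avoid-arc perm (inj₁ (Fin.<⇒≢ i<′j ∘ sym)) ajk) ◅ ε)

    -- The critical case is e = (i , l). Comparison with `ij` gives j < l; here l < k would make e
    -- cross (j , k), and l = k is excluded by `ik∉T`. The mirror image is `ik-before`.
    before-ik : e ∈ T → Before e ij → Before e jk → Before e ik
    before-ik {e = e} e∈ (_ , p , _) (q , _ , r) = q , src≡ , λ eq → Fin.<-trans i<′j (r eq)
      where
      src≡ : src e ≡ i → k < tgt e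
      src≡ refl with Fin.<-cmp k (tgt e)
      ... | tri< k<l _ _  = k<l
      ... | tri≈ _ refl _ = contradiction e∈ ik∉T
      ... | tri> _ _ l<k  = contradiction ajk (noncrossing _ _ _ _ i<′j (p refl) l<k (arc⁺ e∈))

    ik-before : e ∈ T → Before ij e → Before jk e → Before ik e
    ik-before {e = e} e∈ (p , q , _) (_ , _ , r) = p , (λ eq → Fin.<-trans (q eq) j<′k) , tgt≡
      where
      tgt≡ : k ≡ tgt e → src e < i
      tgt≡ refl with Fin.<-cmp (src e) i
      ... | tri< h<i _ _  = h<i
      ... | tri≈ _ refl _ = contradiction e∈ ik∉T
      ... | tri> _ _ i<h  = contradiction (arc⁺ e∈) (noncrossing _ _ _ _ i<h (r refl) j<′k aij)

    ∈u⇒∈T : e ∈ u → e ∈ T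
    ∈u⇒∈T e∈ = there (there (∈.∈-++⁺ˡ e∈))

    ∈v⇒∈T : e ∈ v → e ∈ T
    ∈v⇒∈T e∈ = there (there (∈.∈-++⁺ʳ u e∈))

    ik-before-v : All (Before ik) v
    ik-before-v with (_ ∷ p) ∷ q ∷ _ ← before-rest =
      All.tabulate λ e∈ → ik-before (∈v⇒∈T e∈) (All.lookup p e∈) (All.lookup q e∈)

    before₁ : AllPairs Before (u ++ ik ∷ ij ∷ v)
    before₁ with (_ ∷ p) ∷ _ ∷ q ← before-rest = AllPairs.++⁺ before-uv
      ((((λ eq → Fin.<⇒≢ i<′j (sym eq)) , (λ _ → j<′k) , (λ eq → contradiction (sym eq) (Fin.<⇒≢ j<′k)))
        ∷ ik-before-v) ∷ p ∷ q)
      (All.tabulate λ e∈ → case e∈ (All.lookup before-u e∈))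
      where
      case : ∀ {e} → e ∈ u → All (Before e) (ij ∷ jk ∷ v) → All (Before e) (ik ∷ ij ∷ v)
      case e∈ (p ∷ q ∷ r) = before-ik (∈u⇒∈T e∈) p q ∷ p ∷ r

    before₂ : AllPairs Before (u ++ jk ∷ ik ∷ v)
    before₂ with _ ∷ p ∷ q ← before-rest = AllPairs.++⁺ before-uv
      ((((λ eq → Fin.<⇒≢ j<′k (sym eq)) , (λ eq → contradiction (sym eq) (Fin.<⇒≢ i<′j)) , (λ _ → i<′j))
        ∷ p) ∷ ik-before-v ∷ q)
      (All.tabulate λ e∈ → case e∈ (All.lookup before-u e∈))
      where
      case : ∀ {e} → e ∈ u → All (Before e) (ij ∷ jk ∷ v) → All (Before e) (jk ∷ ik ∷ v)
      case e∈ (p ∷ q ∷ r) = q ∷ before-ik (∈u⇒∈T e∈) p q ∷ r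

  good₁ : GoodWord (u ++ ik ∷ ij ∷ v)
  good₁ = record
    { tree    = NoncrossingTree-resp-↭ (↭-sym (shift₂ ik ij)) (N.tree₁ treeT i-min k-max)
    ; ordered = before₁ }

  good₂ : GoodWord (u ++ jk ∷ ik ∷ v)
  good₂ = record
    { tree    = NoncrossingTree-resp-↭ (↭-sym (shift₂ jk ik)) (N.tree₂ treeT i-min k-max)
    ; ordered = before₂ }

  nasts-good : nasts (u ++ ij ∷ jk ∷ v) ↭ nasts (u ++ ik ∷ ij ∷ v) ++ nasts (u ++ jk ∷ ik ∷ v)
  nasts-good = subst₂ _↭_ (sym (nasts-↭ (shift₂ ij jk)))
    (sym (cong₂ _++_ (nasts-↭ (shift₂ ik ij)) (nasts-↭ (shift₂ jk ik))))
    (N.nasts-reduce treeT i-min k-max)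

-- Noncommutative reduced forms

module _ {n : ℕ} where
  open ℬ {n} using (_∼_; _≈_; Reduce; termSetoid; Swap; IsReducedForm)
  open Words {n} DisjointCommute

  -- The multiset union of the lists `nasts w` over all words w is the invariant of reduction.
  step-good : ∀ {vs ws : List (Word n)} → vs ⟶ ws → All GoodWord vs →
              All GoodWord ws × concatMap nasts vs ↭ concatMap nasts ws
  step-good stop gs = gs , ↭.refl
  step-good (there {w = w} s) (g ∷ gs) = let gs′ , p = step-good s gs in g ∷ gs′ , ↭.++⁺ˡ (nasts w) p
  step-good (here {ws = ws} (reduce u v i<j j<k s)) (g ∷ gs) =
    good₁ ∷ good₂ ∷ gs ,
    ↭-trans (↭.++⁺ʳ (concatMap nasts ws)
        (↭-trans (↭.↭-reflexive (nasts-↭ (∼⇒↭ s))) nasts-good))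
      (↭.++-assoc (nasts _) (nasts _) _)
    where open GoodReduction u v i<j j<k (∼-good s g)

  steps-good : ∀ {P Q : Poly n} → Star Reduce P Q → All GoodWord (zeros P) →
               All GoodWord (zeros Q) × concatMap nasts (zeros P) ↭ concatMap nasts (zeros Q)
  steps-good ε        gs = gs , ↭.refl
  steps-good (r ◅ rs) gs =
    let gs′ , p = step-good (reduce-zeros r) gs ; gs″ , q = steps-good rs gs′ in gs″ , ↭-trans p q

  -- Edges with ends in [i , j) can be moved to the right of (j , k), the other
  -- edges after (i , j) that avoid j can be moved to the left of (i , j).
  good-reducible-at : ∀ u m v {i j k} (i<j : i < j) (j<k : j < k) →
    let w = u ++ edge i j i<j ∷ m ++ edge j k j<k ∷ v in
    GoodWord w → (∀ {m} → Arc w m j → i ≤ m) → (∀ {l} → Arc w j l → l ≤ k) → ∃ (w ↦_)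
  good-reducible-at u m v {i} {j} {k} i<j j<k good i-min k-max =
    _ , reduce (u ++ outs) (ins ++ v) i<j j<k
      (subst (w ∼_) (sym (++-assoc u outs _)) (∼-++ u rearrange))
    where
    open GoodWord good
    open NoncrossingTree tree

    ij jk : Edge n
    ij = edge i j i<j
    jk = edge j k j<k

    w : Word n
    w = u ++ ij ∷ m ++ jk ∷ v

    aij : Arc w i j
    aij = arc⁺ {e = ij} (∈.∈-++⁺ʳ u (here refl))

    Inside : Edge n → Set
    Inside f = i ≤ src f × tgt f < j

    inside? : Decidable Inside
    inside? f = i Fin.≤? src f ×-dec tgt f <? j

    ordered′ : AllPairs Before (ij ∷ m ++ jk ∷ v)
    ordered′ = proj₁ (proj₂ (allPairs-++⁻ u ordered))

    ij-before : ∀ {f} → f ∈ m → Before ij f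
    ij-before f∈ with p ∷ _ ← ordered′ = All.lookup p (∈.∈-++⁺ˡ f∈)

    before-jk : ∀ {f} → f ∈ m → Before f jk
    before-jk f∈ with _ ∷ p ← ordered′ =
      All.head (All.lookup (proj₂ (proj₂ (allPairs-++⁻ m p))) f∈)

    arc-m : ∀ {f} → f ∈ m → Arc w (src f) (tgt f)
    arc-m f∈ = arc⁺ (∈.∈-++⁺ʳ u (there (∈.∈-++⁺ˡ f∈)))

    src≢j : ∀ {f} → f ∈ m → src f ≢ j
    src≢j f∈ refl = ℕ.<⇒≱ (proj₁ (proj₂ (before-jk f∈)) refl) (k-max (arc-m f∈))

    tgt≢j : ∀ {f} → f ∈ m → tgt f ≢ j
    tgt≢j f∈ refl = ℕ.<⇒≱ (proj₂ (proj₂ (ij-before f∈)) refl) (i-min (arc-m f∈))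

    -- An end strictly between i and j would force a crossing with (i , j). At i the order
    -- conditions for edges after `ij` apply, at j the extremality of (i , j) and (j , k).
    ¬inside⇒avoids : ∀ {f} → f ∈ m → ¬ Inside f → ∀ {x} → i ≤ x → x ≤ j → src f ≢ x × tgt f ≢ x
    ¬inside⇒avoids {f} f∈ ¬in {x} i≤x x≤j with x ≟ j | x ≟ i
    ... | yes refl | _ = src≢j f∈ , tgt≢j f∈
    ... | no x≢j | yes refl =
      (λ { refl → ¬in (ℕ.≤-refl , proj₁ (proj₂ (ij-before f∈)) refl) }) , proj₁ (ij-before f∈)
    ... | no x≢j | no x≢i = source , target
      where
      i<x = Fin.≤∧≢⇒< i≤x (x≢i ∘ sym)
      x<j = Fin.≤∧≢⇒< x≤j x≢j

      source : src f ≢ x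
      source refl with Fin.<-cmp (tgt f) j
      ... | tri< l<j _ _ = ¬in (i≤x , l<j)
      ... | tri≈ _ eq _  = tgt≢j f∈ eq
      ... | tri> _ _ j<l = noncrossing _ _ _ _ i<x x<j j<l aij (arc-m f∈)

      target : tgt f ≢ x
      target refl with i Fin.≤? src f
      ... | yes i≤h = ¬in (i≤h , x<j)
      ... | no i≰h  = noncrossing _ _ _ _ (ℕ.≰⇒> i≰h) i<x x<j (arc-m f∈) aij

    outs ins : Word n
    outs = filter (¬? ∘ inside?) m
    ins  = filter inside? m

    commute-out : ∀ {e f} → f ∈ m → ¬ Inside f → i ≤ src e → tgt e ≤ j → DisjointCommute e f
    commute-out {e} f∈ ¬in i≤ ≤j =
      let p , q = ¬inside⇒avoids f∈ ¬in i≤ (ℕ.≤-trans (ℕ.<⇒≤ (src<tgt′ e)) ≤j)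
          r , s = ¬inside⇒avoids f∈ ¬in (ℕ.≤-trans i≤ (ℕ.<⇒≤ (src<tgt′ e))) ≤j
      in p ∘ sym , q ∘ sym , r ∘ sym , s ∘ sym

    ∈outs : ∀ {f} → f ∈ outs → f ∈ m × ¬ Inside f
    ∈outs = ∈.∈-filter⁻ (¬? ∘ inside?) {xs = m}

    jk-ins : All (DisjointCommute jk) ins
    jk-ins = All.tabulate λ {f} f∈ →
      let _ , _ , <j = ∈.∈-filter⁻ inside? {xs = m} f∈
          <k = ℕ.<-trans <j j<k
          lt = src<tgt′ f
      in Fin.<⇒≢ (ℕ.<-trans lt <j) ∘ sym , Fin.<⇒≢ <j ∘ sym ,
         Fin.<⇒≢ (ℕ.<-trans lt <k) ∘ sym , Fin.<⇒≢ <k ∘ sym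

    -- First `m` is sorted into `outs ++ ins`, then `ij` passes `outs`, and finally `jk` passes
    -- `ins`.
    rearrange : ij ∷ m ++ jk ∷ v ∼ outs ++ ij ∷ jk ∷ ins ++ v
    rearrange = ∼-cons ij (∼-partition inside? m (λ {e} (i≤ , <j) f∈ ¬in → commute-out {e} f∈ ¬in i≤ (ℕ.<⇒≤ <j)))
      ◅◅ ∼-move outs (All.tabulate λ f∈ →
           let f∈m , ¬in = ∈outs f∈ in commute-out {ij} f∈m ¬in ℕ.≤-refl ℕ.≤-refl)
      ◅◅ ∼-++ outs (∼-cons ij (∼-sym (∼-move ins jk-ins)))

  good-irreducible : {w : Word n} → GoodWord w → ¬ ∃ (w ↦_) → Alternating w
  good-irreducible {w} good irr with alternating-or-pair w
  ... | inj₁ alt  = alt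
  ... | inj₂ pair = contradiction
    (reducible (arc-< ij) (arc-< jk) (∈-arc ij) (∈-arc jk) good i-min k-max) irr
    where
    open LongestPair pair
    reducible : ∀ {w i j k} (i<j : i < j) (j<k : j < k) → edge i j i<j ∈ w → edge j k j<k ∈ w →
      GoodWord w → (∀ {m} → Arc w m j → i ≤ m) → (∀ {l} → Arc w j l → l ≤ k) → ∃ (w ↦_)
    reducible i<j j<k ij∈ jk∈ good i-min k-max with u , rest , refl ← ∈.∈-∃++ ij∈
      with ∈.∈-++⁻ u jk∈ | allPairs-++⁻ u (GoodWord.ordered good)
    -- By (i), `jk` cannot precede `ij`: `Before` would demand j ≢ j.
    ... | inj₁ jk∈u          | _ , _ , p with (q , _) ∷ _ ← All.lookup p jk∈u = contradiction refl q
    ... | inj₂ (here eq)     | _ = contradiction (sym (cong src eq)) (Fin.<⇒≢ i<j)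
    ... | inj₂ (there jk∈r)  | _ with m , v , refl ← ∈.∈-∃++ jk∈r =
      good-reducible-at u m v i<j j<k good i-min k-max

  -- The least edge `s` moves to the front: no entry before it is ≺ `s`, so all of them are disjoint
  -- from it.
  sort-word : {S w : Word n} → LexLabeled S → AllPairs (λ e f → DisjointCommute e f ⊎ e ≺ f) w →
              w ↭ S → w ∼ S
  sort-word {[]} [] _ perm with refl ← ↭.↭-empty-inv perm = ε
  sort-word {s ∷ S} (s≺ ∷ sorted) ps perm
    with p , q , refl ← ∈.∈-∃++ (↭.∈-resp-↭ (↭-sym perm) (here refl))
    with ps₁ , _ ∷ ps₂ , ps₁₂ ← allPairs-++⁻ p ps =
    ∼-sym (∼-move p (All.tabulate λ x∈ → disjoint x∈ (All.head (All.lookup ps₁₂ x∈))))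
    ◅◅ ∼-cons s (sort-word sorted (AllPairs.++⁺ ps₁ ps₂ (All.map All.tail ps₁₂))
                   (↭.drop-∷ (↭-trans (↭-sym (↭.shift s p q)) perm)))
    where
    disjoint : ∀ {x} → x ∈ p → DisjointCommute x s ⊎ x ≺ s → DisjointCommute s x
    disjoint {x} x∈ (inj₁ d) = disjoint-sym x s d
    disjoint {x} x∈ (inj₂ x≺s) with ↭.∈-resp-↭ perm (∈.∈-++⁺ˡ x∈)
    ... | here refl = contradiction x≺s (lex-irrefl {e = s})
    ... | there x∈S = contradiction x≺s (lex-asym {e = s} {x} (All.lookup s≺ x∈S))

  -- In an alternating graph, edges that meet share a source or a target, and for such edges
  -- `Before` implies `≺`.
  alternating-∼-lexsort : {w : Word n} → GoodWord w → Alternating w → w ∼ lexsort w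
  alternating-∼-lexsort {w} good alt =
    sort-word (lexsort-sorted w) (pairs ordered λ e∈ → e∈)
      (∼bag⇒↭ (unique∧set⇒bag (AllPairs.map (λ { {e} p refl → before-irrefl e p }) ordered)
        (lex-unique (lexsort-sorted w)) (mk⇔ ∈-lexsort⁺ (∈-lexsort⁻ {G = w}))))
    where
    open GoodWord good

    disjoint-or-≺ : ∀ {e f} → e ∈ w → f ∈ w → Before e f → DisjointCommute e f ⊎ e ≺ f
    disjoint-or-≺ {e} {f} e∈ f∈ (_ , p , q) with src e ≟ src f | tgt e ≟ tgt f
    ... | yes eq | _      = inj₂ (inj₁ (p eq))
    ... | no _   | yes eq = inj₂ (inj₂ (eq , q eq))
    ... | no ne  | no ne′ = inj₁ (ne ,
      (λ eq → alt _ _ _ (subst (Arc w _) (sym eq) (arc⁺ f∈)) (arc⁺ e∈)) ,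
      (λ eq → alt _ _ _ (subst (Arc w _) eq (arc⁺ e∈)) (arc⁺ f∈)) , ne′)

    pairs : ∀ {w′} → AllPairs Before w′ → (∀ {e} → e ∈ w′ → e ∈ w) →
            AllPairs (λ e f → DisjointCommute e f ⊎ e ≺ f) w′
    pairs []       _   = []
    pairs (p ∷ ps) sub =
      All.tabulate (λ f∈ → disjoint-or-≺ (sub (here refl)) (sub (there f∈)) (All.lookup p f∈))
      ∷ pairs ps (sub ∘ there)

  good-leaves : {ws : List (Word n)} → All GoodWord ws → All (λ w → ¬ ∃ (w ↦_)) ws →
                Pointwise (Setoid._≈_ termSetoid) (map monomial ws) (map monomial (map lexsort ws))
  good-leaves []       []           = []
  good-leaves (g ∷ gs) (irr ∷ irrs) =
    (refl , alternating-∼-lexsort g (good-irreducible g irr)) ∷ good-leaves gs irrs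

  nasts-leaves : {ws : List (Word n)} → All GoodWord ws → All (λ w → ¬ ∃ (w ↦_)) ws →
                 concatMap nasts ws ≡ map lexsort ws
  nasts-leaves []       []           = refl
  nasts-leaves (g ∷ gs) (irr ∷ irrs) = cong₂ _++_
    (nasts-alternating (GoodWord.tree g) (good-irreducible g irr)) (nasts-leaves gs irrs)

  goodTree⇒goodWord : {L : Graph n} → IsGoodTree L → GoodWord L
  goodTree⇒goodWord {L} (good , tree) = record
    { tree    = record { noncrossing = noncrossing ; connected = proj₂ tree
                       ; edges = tree-length tree }
    ; ordered = ordered L (proj₁ (proj₁ tree)) tgt≡src src≡src tgt≡tgt }
    where
    open IsGoodForest good
    -- The label conditions are arguments, so that they can be restricted to the tail of the list.
    ordered : ∀ L → Unique L →
      (∀ a b → tgt (lookup L a) ≡ src (lookup L b) → a < b) →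
      (∀ a b → src (lookup L a) ≡ src (lookup L b) → tgt (lookup L a) < tgt (lookup L b) → b < a) →
      (∀ a b → tgt (lookup L a) ≡ tgt (lookup L b) → src (lookup L a) < src (lookup L b) → b < a) →
      AllPairs Before L
    ordered []      _        _ _ _ = []
    ordered (e ∷ L) (e∉ ∷ un) h₁ h₂ h₃ =
      All.tabulate (λ {f} f∈ → subst (Before e) (sym (AnyP.lookup-index f∈)) (before-head (Any.index f∈)
        (subst (e ≢_) (AnyP.lookup-index f∈) (All.lookup e∉ f∈))))
      ∷ ordered L un
          (λ a b eq → ℕ.s<s⁻¹ (h₁ (suc a) (suc b) eq))
          (λ a b eq lt → ℕ.s<s⁻¹ (h₂ (suc a) (suc b) eq lt))
          (λ a b eq lt → ℕ.s<s⁻¹ (h₃ (suc a) (suc b) eq lt))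
      where
      before-head : ∀ b → e ≢ lookup L b → Before e (lookup L b)
      before-head b e≢ = (λ eq → case (h₁ (suc b) zero eq)) , src≡ , tgt≡
        where
        case : ∀ {m} {a : Fin m} → ¬ suc a < (zero {m})
        case ()
        src≡ : src e ≡ src (lookup L b) → tgt (lookup L b) < tgt e
        src≡ eq with Fin.<-cmp (tgt (lookup L b)) (tgt e)
        ... | tri< lt _ _ = lt
        ... | tri≈ _ eq′ _ = contradiction (edge-≡ eq (sym eq′)) e≢
        ... | tri> _ _ gt with () ← h₂ zero (suc b) eq gt
        tgt≡ : tgt e ≡ tgt (lookup L b) → src (lookup L b) < src e
        tgt≡ eq with Fin.<-cmp (src (lookup L b)) (src e)
        ... | tri< lt _ _ = lt
        ... | tri≈ _ eq′ _ = contradiction (edge-≡ (sym eq′) eq) e≢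
        ... | tri> _ _ gt with () ← h₃ zero (suc b) eq gt

  -- Up to commutations every irreducible word is its lexicographic sorting, the single entry of its
  -- `nasts`. By invariance these entries together form `nasts L`.
  noncommutative : {T L : Graph n} → L ↭ T → IsGoodTree L →
                   (P : Poly n) → IsReducedForm (monomial L) P → P [β≔ 0 ] ≈ ∑nasts T
  noncommutative {T} {L} L↭T goodL P (steps , irr) =
    let gs , p = steps-good steps (goodTree⇒goodWord goodL ∷ [])
        irrs   = irreducible-zeros P irr
    in subst (_≈ ∑nasts T) (sym ([β≔0]-zeros P))
      (PermutationSetoid.↭-trans termSetoid
        (PermutationSetoid.refl (good-leaves gs irrs))
        (↭.↭⇒↭ₛ′ (Setoid.isEquivalence termSetoid)
          (↭.map⁺ monomial (↭-trans (↭.↭-reflexive (sym (nasts-leaves gs irrs)))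
            (↭-trans (↭-sym p) (↭.↭-reflexive (trans (++-identityʳ (nasts L)) (nasts-↭ L↭T))))))))

-- Sums over flagged coefficients

sumTo : ℕ → (ℕ → ℕ) → ℕ
sumTo zero    f = f 0
sumTo (suc H) f = f 0 + sumTo H (f ∘ suc)

sumTo-cong : ∀ H → (∀ c → φ c ≡ ψ c) → sumTo H φ ≡ sumTo H ψ
sumTo-cong zero    eq = eq 0
sumTo-cong (suc H) eq = cong₂ _+_ (eq 0) (sumTo-cong H (eq ∘ suc))

sumTo-0 : ∀ H → sumTo H (λ _ → 0) ≡ 0
sumTo-0 zero    = refl
sumTo-0 (suc H) = sumTo-0 H

sumTo-restrict : ∀ {r H} → r ℕ.≤ H → (∀ c → c ℕ.≤ r → φ c ≡ ψ c) → (∀ c → r ℕ.< c → φ c ≡ 0) →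
                 sumTo H φ ≡ sumTo r ψ
sumTo-restrict {H = zero}  z≤n eq _    = eq 0 z≤n
sumTo-restrict {H = suc H} z≤n eq zero′ =
  trans (cong₂ _+_ (eq 0 z≤n) (trans (sumTo-cong H (λ c → zero′ (suc c) (s≤s z≤n))) (sumTo-0 H)))
    (ℕ.+-identityʳ _)
sumTo-restrict (s≤s le) eq zero′ = cong₂ _+_ (eq 0 z≤n)
  (sumTo-restrict le (λ c → eq (suc c) ∘ s≤s) (λ c → zero′ (suc c) ∘ s≤s))

sumTo-pad : ∀ H → φ (suc H) ≡ 0 → sumTo (suc H) φ ≡ sumTo H φ
sumTo-pad {φ = φ} zero    eq = trans (cong (φ 0 +_) eq) (ℕ.+-identityʳ _)
sumTo-pad {φ = φ} (suc H) eq = cong (φ 0 +_) (sumTo-pad H eq)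

sumTo-+ : ∀ H (f g : ℕ → ℕ) → sumTo H (λ c → f c + g c) ≡ sumTo H f + sumTo H g
sumTo-+ zero    f g = refl
sumTo-+ (suc H) f g = trans (cong (f 0 + g 0 +_) (sumTo-+ H (f ∘ suc) (g ∘ suc)))
  (solve 4 (λ a b x y → a :+ b :+ (x :+ y) := a :+ x :+ (b :+ y)) refl (f 0) (g 0) _ _)

sumTo-* : ∀ H k (f : ℕ → ℕ) → k * sumTo H f ≡ sumTo H (λ c → k * f c)
sumTo-* zero    k f = refl
sumTo-* (suc H) k f = trans (ℕ.*-distribˡ-+ k (f 0) _) (cong (k * f 0 +_) (sumTo-* H k (f ∘ suc)))

sumTo-swap : ∀ A B (h : ℕ → ℕ → ℕ) →
             sumTo A (λ a → sumTo B (h a)) ≡ sumTo B (λ b → sumTo A (λ a → h a b))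
sumTo-swap zero    B h = refl
sumTo-swap (suc A) B h = trans (cong (sumTo B (h 0) +_) (sumTo-swap A B (h ∘ suc)))
  (sym (sumTo-+ B (h 0) (λ b → sumTo A (λ a → h (suc a) b))))

-- Flagged coefficients must be positive: the facet on which they vanish is removed.
allowed : Bool → ℕ → ℕ
allowed false _       = 1
allowed true  zero    = 0
allowed true  (suc _) = 1

-- Finite support lets all sums share the bound `H`, although the substitutions a = b + c and b = a
-- + c do not preserve the square.
Supported : ℕ → (ℕ → ℕ → ℕ) → Set
Supported H h = ∀ a b → H ℕ.< a ⊎ H ℕ.< b → h a b ≡ 0

-- The pairs (a , b) with a ≥ b are the (b + c , b), those with a < b the (a , a + c) with c > 0.
triangles : ∀ H (h : ℕ → ℕ → ℕ) → Supported H h →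
  sumTo H (λ a → sumTo H (h a)) ≡
  sumTo H (λ b → sumTo H (λ c → h (b + c) b)) +
  sumTo H (λ a → sumTo H (λ c → allowed true c * h a (a + c)))
triangles zero    h _    = sym (ℕ.+-identityʳ _)
triangles (suc H) h supp = begin
  -- Row and column 0 are split off; the remaining square is that of `h` shifted along the diagonal.
  h 0 0 + sumTo H (h 0 ∘ suc) + sumTo H (λ a → h (suc a) 0 + sumTo H (h′ a))
    ≡⟨ cong (h 0 0 + sumTo H (h 0 ∘ suc) +_)
         (trans (sumTo-+ H (λ a → h (suc a) 0) _) (cong (sumTo H (λ a → h (suc a) 0) +_)
           (triangles H h′ (λ a b → supp (suc a) (suc b) ∘ Sum.map s≤s s≤s)))) ⟩
  h 0 0 + sumTo H (h 0 ∘ suc) + (sumTo H (λ a → h (suc a) 0) + (S₁ + S₂))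
    ≡⟨ solve 5 (λ a x y s t → a :+ x :+ (y :+ (s :+ t)) := a :+ y :+ s :+ (x :+ t)) refl
         (h 0 0) (sumTo H (h 0 ∘ suc)) (sumTo H (λ a → h (suc a) 0)) S₁ S₂ ⟩
  h 0 0 + sumTo H (λ a → h (suc a) 0) + S₁ + (sumTo H (h 0 ∘ suc) + S₂)
    ≡⟨ cong₂ (λ x y → h 0 0 + sumTo H (λ a → h (suc a) 0) + x + y)
         (sumTo-cong H λ b → sym (sumTo-pad H (supp _ _ (inj₁ (s≤s (ℕ.m≤n+m (suc H) b))))))
         (cong₂ _+_ (sumTo-cong H λ c → sym (ℕ.+-identityʳ _))
           (sumTo-cong H λ a → sym (sumTo-pad H (trans (ℕ.+-identityʳ _)
             (supp _ _ (inj₂ (s≤s (ℕ.m≤n+m (suc H) a)))))))) ⟩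
  sumTo (suc H) (λ b → sumTo (suc H) (λ c → h (b + c) b)) +
  sumTo (suc H) (λ a → sumTo (suc H) (λ c → allowed true c * h a (a + c))) ∎
  where
  open ≡-Reasoning
  h′ = λ a b → h (suc a) (suc b)
  S₁ = sumTo H (λ b → sumTo H (λ c → h′ (b + c) b))
  S₂ = sumTo H (λ a → sumTo H (λ c → allowed true c * h′ a (a + c)))

-- Where the diagonal a = b goes, so that the two half-open cones of a
-- reduction partition the half-open cone they subdivide.
tie : Bool → Bool → Bool
tie true false = true
tie _    _     = false

-- The smaller of a and b becomes the coefficient of the new edge and keeps its flag; the flag of
-- the larger one is then automatic. If only a is flagged, a = b = 0 must stay excluded, so the
-- diagonal goes to the part where a keeps its flag.
split-flags : ∀ H σ σ′ (h : ℕ → ℕ → ℕ) → Supported H h →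
  sumTo H (λ a → allowed σ a * sumTo H (λ b → allowed σ′ b * h a b)) ≡
  sumTo H (λ b → allowed σ′ b * sumTo H (λ c → allowed (tie σ σ′) c * h (b + c) b)) +
  sumTo H (λ c → allowed (not (tie σ σ′)) c * sumTo H (λ a → allowed σ a * h a (a + c)))
split-flags H σ σ′ h supp = begin
  sumTo H (λ a → allowed σ a * sumTo H (λ b → allowed σ′ b * h a b))
    ≡⟨ sumTo-cong H (λ a → sumTo-* H (allowed σ a) _) ⟩
  sumTo H (λ a → sumTo H (w σ σ′ a))
    ≡⟨ cases σ σ′ ⟩
  sumTo H (λ b → sumTo H (λ c → allowed σ′ b * (allowed (tie σ σ′) c * h (b + c) b))) +
  sumTo H (λ a → sumTo H (λ c → allowed (not (tie σ σ′)) c * (allowed σ a * h a (a + c))))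
    ≡⟨ cong₂ _+_ (sumTo-cong H λ b → sym (sumTo-* H (allowed σ′ b) _))
         (trans (sumTo-swap H H _) (sumTo-cong H λ c → sym (sumTo-* H (allowed (not (tie σ σ′)) c) _))) ⟩
  _ ∎
  where
  open ≡-Reasoning

  w : Bool → Bool → ℕ → ℕ → ℕ
  w σ σ′ a b = allowed σ a * (allowed σ′ b * h a b)

  supp′ : ∀ σ σ′ → Supported H (w σ σ′)
  supp′ σ σ′ a b out = trans (cong (λ x → allowed σ a * (allowed σ′ b * x)) (supp a b out))
    (trans (cong (allowed σ a *_) (ℕ.*-zeroʳ (allowed σ′ b))) (ℕ.*-zeroʳ (allowed σ a)))

  *-swap : ∀ x y z → x * (y * z) ≡ y * (x * z)
  *-swap = solve 3 (λ x y z → x :* (y :* z) := y :* (x :* z)) refl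

  positive-sum : ∀ a c x → allowed true (a + c) * (allowed true a * x) ≡ allowed true a * (1 * x)
  positive-sum zero    c x = ℕ.*-zeroʳ (allowed true c)
  positive-sum (suc a) c x = refl

  positive-sum′ : ∀ a c x → allowed true c * (allowed true (a + c) * x) ≡ allowed true c * x
  positive-sum′ a zero    x = refl
  positive-sum′ a (suc c) x rewrite ℕ.+-suc a c = cong (_+ 0) (ℕ.+-identityʳ x)

  cases : ∀ σ σ′ → sumTo H (λ a → sumTo H (w σ σ′ a)) ≡
    sumTo H (λ b → sumTo H (λ c → allowed σ′ b * (allowed (tie σ σ′) c * h (b + c) b))) +
    sumTo H (λ a → sumTo H (λ c → allowed (not (tie σ σ′)) c * (allowed σ a * h a (a + c))))
  cases false false = trans (triangles H (w false false) (supp′ false false))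
    (cong₂ _+_ refl (sumTo-cong H λ a → sumTo-cong H λ c → cong (allowed true c *_) (ℕ.*-identityˡ _)))
  cases false true  = trans (triangles H (w false true) (supp′ false true)) (cong₂ _+_
    (sumTo-cong H λ b → sumTo-cong H λ c → *-swap 1 (allowed true b) (h (b + c) b))
    (sumTo-cong H λ a → sumTo-cong H λ c →
      trans (cong (allowed true c *_) (ℕ.*-identityˡ _))
        (trans (positive-sum′ a c _) (cong (allowed true c *_) (sym (ℕ.*-identityˡ _))))))
  cases true  true  = trans (triangles H (w true true) (supp′ true true)) (cong₂ _+_
    (sumTo-cong H λ b → sumTo-cong H λ c → positive-sum b c (h (b + c) b))
    (sumTo-cong H λ a → sumTo-cong H λ c →
      trans (cong (allowed true c *_) (*-swap (allowed true a) (allowed true (a + c)) _))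
        (positive-sum′ a c _)))
  -- Here the strict part is a > b, so `triangles` is applied with a and b exchanged.
  cases true  false = trans (sumTo-swap H H _)
    (trans (triangles H (λ b a → w true false a b) (λ b a → supp′ true false a b ∘ Sum.swap))
      (trans (ℕ.+-comm (sumTo H (λ a → sumTo H (λ c → w true false a (a + c)))) _) (cong₂ _+_
        (sumTo-cong H λ b → sumTo-cong H λ c →
          trans (cong (allowed true c *_) (cong (allowed true (b + c) *_) (ℕ.*-identityˡ _)))
            (trans (positive-sum′ b c _) (sym (ℕ.*-identityˡ _))))
        (sumTo-cong H λ a → sumTo-cong H λ c →
          *-swap (allowed true a) 1 (h a (a + c))))))

-- Lattice points of half-open cones

-- (e , c) stands for c (e_i − e_j), where e is the edge (i , j).
Combination : ℕ → Set
Combination n = List (Edge n × ℕ)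

FlaggedWord : ℕ → Set
FlaggedWord n = List (Edge n × Bool)

-- With `slice` for `F` this counts lattice points, represented by their coefficient vectors.
total : ℕ → (Combination n → ℕ) → FlaggedWord n → ℕ
total H F []            = F []
total H F ((e , σ) ∷ w) = sumTo H (λ c → allowed σ c * total H (λ cs → F ((e , c) ∷ cs)) w)

total-cong : ∀ H {F G : Combination n → ℕ} w → (∀ cs → map proj₁ cs ≡ map proj₁ w → F cs ≡ G cs) →
             total H F w ≡ total H G w
total-cong H []            eq = eq [] refl
total-cong H ((e , σ) ∷ w) eq = sumTo-cong H λ c → cong (allowed σ c *_)
  (total-cong H w λ cs p → eq ((e , c) ∷ cs) (cong (e ∷_) p))

total-0 : ∀ H (F : Combination n → ℕ) w → (∀ cs → F cs ≡ 0) → total H F w ≡ 0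
total-0 H F []            eq = eq []
total-0 H F ((e , σ) ∷ w) eq = trans (sumTo-cong H λ c →
  trans (cong (allowed σ c *_) (total-0 H _ w λ cs → eq ((e , c) ∷ cs))) (ℕ.*-zeroʳ (allowed σ c)))
  (sumTo-0 H)

Symmetrical : (Combination n → ℕ) → Set
Symmetrical F = ∀ {cs ds} → cs ↭ ds → F cs ≡ F ds

total-↭ : ∀ H {F : Combination n → ℕ} → Symmetrical F → ∀ {v w} → v ↭ w → total H F v ≡ total H F w
total-↭ H sy ↭.refl = refl
total-↭ H sy (↭.prep (e , σ) p) = sumTo-cong H λ c → cong (allowed σ c *_) (total-↭ H (sy ∘ ↭.prep _) p)
total-↭ H sy (↭.trans p q) = trans (total-↭ H sy p) (total-↭ H sy q)
total-↭ H {F} sy (↭.swap {xs} {ys} (e , σ) (f , τ) p) = begin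
  sumTo H (λ a → allowed σ a * sumTo H (λ b → allowed τ b * X a b))
    ≡⟨ sumTo-cong H (λ a → sumTo-* H (allowed σ a) _) ⟩
  sumTo H (λ a → sumTo H (λ b → allowed σ a * (allowed τ b * X a b)))
    ≡⟨ sumTo-swap H H _ ⟩
  sumTo H (λ b → sumTo H (λ a → allowed σ a * (allowed τ b * X a b)))
    ≡⟨ sumTo-cong H (λ b → sumTo-cong H λ a → trans
         (solve 3 (λ x y z → x :* (y :* z) := y :* (x :* z)) refl (allowed σ a) (allowed τ b) _)
         (cong (λ z → allowed τ b * (allowed σ a * z))
           (trans (total-↭ H (λ q → sy (↭.prep _ (↭.prep _ q))) p)
             (total-cong H ys λ cs _ → sy (↭.swap _ _ ↭.refl))))) ⟩
  sumTo H (λ b → sumTo H (λ a → allowed τ b * (allowed σ a * Y b a)))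
    ≡⟨ sumTo-cong H (λ b → sumTo-* H (allowed τ b) _) ⟨
  sumTo H (λ b → allowed τ b * sumTo H (λ a → allowed σ a * Y b a)) ∎
  where
  open ≡-Reasoning
  X = λ a b → total H (λ cs → F ((e , a) ∷ (f , b) ∷ cs)) xs
  Y = λ b a → total H (λ cs → F ((f , b) ∷ (e , a) ∷ cs)) ys

δ : ∀ {m} → Fin m → Fin m → ℕ
δ x y = if does (x ≟ y) then 1 else 0

δ-≢ : ∀ {m} (x y : Fin m) → x ≢ y → δ x y ≡ 0
δ-≢ x y x≢y rewrite dec-false (x ≟ y) x≢y = refl

weighted : (Edge n → ℕ) → Combination n → ℕ
weighted φ []             = 0
weighted φ ((e , c) ∷ cs) = φ e * c + weighted φ cs

weighted-↭ : ∀ (φ : Edge n → ℕ) {cs ds} → cs ↭ ds → weighted φ cs ≡ weighted φ ds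
weighted-↭ φ ↭.refl = refl
weighted-↭ φ (↭.prep (e , c) p) = cong (φ e * c +_) (weighted-↭ φ p)
weighted-↭ φ (↭.swap {xs} (e , c) (f , d) p) = trans
  (solve 3 (λ a b c → a :+ (b :+ c) := b :+ (a :+ c)) refl (φ e * c) (φ f * d) (weighted φ xs))
  (cong (λ z → φ f * d + (φ e * c + z)) (weighted-↭ φ p))
weighted-↭ φ (↭.trans p q) = trans (weighted-↭ φ p) (weighted-↭ φ q)

weighted-0 : ∀ (φ : Edge n → ℕ) cs → All (λ e → φ e ≡ 0) (map proj₁ cs) → weighted φ cs ≡ 0
weighted-0 φ []             []       = refl
weighted-0 φ ((e , c) ∷ cs) (p ∷ ps) rewrite p = weighted-0 φ cs ps

-- The coordinate of the vector at x is `out x cs` minus `into x cs`.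
out into : Vertex n → Combination n → ℕ
out  x = weighted (λ e → δ (src e) x)
into x = weighted (λ e → δ (tgt e) x)

-- Subtraction is truncated: only the positive coordinates of the vector count.
positive : Combination n → ℕ
positive cs = sum (λ x → out x cs ∸ into x cs)

-- The value of the linear functional e_i ↦ −i; it bounds all coefficients.
height : Combination n → ℕ
height = weighted (λ e → toℕ (tgt e) ∸ toℕ (src e))

multiplicity : Combination n → ℕ
multiplicity []             = 0
multiplicity ((e , c) ∷ cs) = c + multiplicity cs

indicator : Bool → ℕ
indicator b = if b then 1 else 0

inBounds : ℕ → ℕ → ℕ → ℕ → ℕ
inBounds H t p h = indicator ((p ≡ᵇ t) ∧ (h ≤ᵇ H))

inBounds-0 : ∀ {H t p h} → H ℕ.< h → inBounds H t p h ≡ 0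
inBounds-0 {H} {t} {p} {h} H<h with h ≤ᵇ H | ℕ.≤ᵇ⇒≤ h H
... | true  | h≤H = contradiction (h≤H tt) (ℕ.<⇒≱ H<h)
... | false | _   = cong indicator (∧-zeroʳ (p ≡ᵇ t))

-- The indicator function of the slice {positive = t}, cut off at a height that
-- no combination of an alternating graph in this slice exceeds.
slice : ℕ → Combination n → ℕ
slice {n} t cs = inBounds (n * t) t (positive cs) (height cs)

slice-symmetrical : ∀ t → Symmetrical (slice {n} t)
slice-symmetrical {n} t {cs} {ds} p = cong₂ (inBounds (n * t) t)
  (sum-cong-≗ {x = λ x → out x cs ∸ into x cs} {y = λ x → out x ds ∸ into x ds} λ x →
    cong₂ _∸_ (weighted-↭ (λ e → δ (src e) x) p) (weighted-↭ (λ e → δ (tgt e) x) p))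
  (weighted-↭ (λ e → toℕ (tgt e) ∸ toℕ (src e)) p)

coefficient≤height : ∀ {e : Edge n} {c} {cs} → (e , c) ∈ cs → c ℕ.≤ height cs
coefficient≤height {e = e} {c} (here refl) = ℕ.≤-trans
  (ℕ.m≤n*m c (toℕ (tgt e) ∸ toℕ (src e)) {{ℕ.>-nonZero (ℕ.m<n⇒0<n∸m (src<tgt′ e))}}) (ℕ.m≤m+n _ _)
coefficient≤height (there e∈) = ℕ.≤-trans (coefficient≤height e∈) (ℕ.m≤n+m _ _)

slice-supported : ∀ t {e : Edge n} {c cs} → (e , c) ∈ cs → n * t ℕ.< c → slice t cs ≡ 0
slice-supported {n} t {cs = cs} e∈ H<c =
  inBounds-0 {t = t} {p = positive cs} (ℕ.<-≤-trans H<c (coefficient≤height e∈))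

module _ {i j k : Vertex n} .(i<j : i < j) .(j<k : j < k) where

  private
    ij jk ik : Edge n
    ij = edge i j i<j
    jk = edge j k j<k
    ik = edge i k (Fin.<-trans i<j j<k)

  length-ik : toℕ k ∸ toℕ i ≡ (toℕ j ∸ toℕ i) + (toℕ k ∸ toℕ j)
  length-ik = ℕ.+-cancelˡ-≡ (toℕ i) _ _ (trans (ℕ.m+[n∸m]≡n (ℕ.<⇒≤ (src<tgt′ ik)))
    (sym (trans (sym (ℕ.+-assoc (toℕ i) _ _))
      (trans (cong (_+ (toℕ k ∸ toℕ j)) (ℕ.m+[n∸m]≡n (ℕ.<⇒≤ (src<tgt′ ij))))
        (ℕ.m+[n∸m]≡n (ℕ.<⇒≤ (src<tgt′ jk)))))))

  -- The vectors agree because that of `ik` is the sum of those of `ij` and `jk`: `out` and `into`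
  -- both lose the contribution b at j, which cancels in the truncated difference. Heights agree
  -- since lengths add up.
  slice-≥ : ∀ t b c cs → slice t ((ij , b + c) ∷ (jk , b) ∷ cs) ≡ slice t ((ik , b) ∷ (ij , c) ∷ cs)
  slice-≥ t b c cs = cong₂ (inBounds (n * t) t)
    (sum-cong-≗ λ x → trans
      (cong₂ _∸_
        (solve 5 (λ i j b c z → i :* (b :+ c) :+ (j :* b :+ z) := j :* b :+ (i :* b :+ (i :* c :+ z)))
          refl (δ i x) (δ j x) b c (out x cs))
        (solve 5 (λ j k b c z → j :* (b :+ c) :+ (k :* b :+ z) := j :* b :+ (k :* b :+ (j :* c :+ z)))
          refl (δ j x) (δ k x) b c (into x cs)))
      (ℕ.[m+n]∸[m+o]≡n∸o (δ j x * b) _ _))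
    (trans (solve 5 (λ p q b c z → p :* (b :+ c) :+ (q :* b :+ z) := (p :+ q) :* b :+ (p :* c :+ z))
        refl (toℕ j ∸ toℕ i) (toℕ k ∸ toℕ j) b c (height cs))
      (cong (λ l → l * b + ((toℕ j ∸ toℕ i) * c + height cs)) (sym length-ik)))

  slice-≤ : ∀ t a c cs → slice t ((ij , a) ∷ (jk , a + c) ∷ cs) ≡ slice t ((jk , c) ∷ (ik , a) ∷ cs)
  slice-≤ t a c cs = cong₂ (inBounds (n * t) t)
    (sum-cong-≗ λ x → trans
      (cong₂ _∸_
        (solve 5 (λ i j a c z → i :* a :+ (j :* (a :+ c) :+ z) := j :* a :+ (j :* c :+ (i :* a :+ z)))
          refl (δ i x) (δ j x) a c (out x cs))
        (solve 5 (λ j k a c z → j :* a :+ (k :* (a :+ c) :+ z) := j :* a :+ (k :* c :+ (k :* a :+ z)))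
          refl (δ j x) (δ k x) a c (into x cs)))
      (ℕ.[m+n]∸[m+o]≡n∸o (δ j x * a) _ _))
    (trans (solve 5 (λ p q a c z → p :* a :+ (q :* (a :+ c) :+ z) := q :* c :+ ((p :+ q) :* a :+ z))
        refl (toℕ j ∸ toℕ i) (toℕ k ∸ toℕ j) a c (height cs))
      (cong (λ l → (toℕ k ∸ toℕ j) * c + (l * a + height cs)) (sym length-ik)))

  total-reduce : ∀ t σ σ′ (w : FlaggedWord n) → let Φ = total (n * t) (slice t) in
    Φ ((ij , σ) ∷ (jk , σ′) ∷ w) ≡
    Φ ((ik , σ′) ∷ (ij , tie σ σ′) ∷ w) + Φ ((jk , not (tie σ σ′)) ∷ (ik , σ) ∷ w)
  total-reduce t σ σ′ w = trans (split-flags N σ σ′ X supported) (cong₂ _+_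
    (sumTo-cong N λ b → cong (allowed σ′ b *_) (sumTo-cong N λ c →
      cong (allowed (tie σ σ′) c *_) (total-cong N w λ cs _ → slice-≥ t b c cs)))
    (sumTo-cong N λ c → cong (allowed (not (tie σ σ′)) c *_) (sumTo-cong N λ a →
      cong (allowed σ a *_) (total-cong N w λ cs _ → slice-≤ t a c cs))))
    where
    N = n * t
    X = λ a b → total N (λ cs → slice t ((ij , a) ∷ (jk , b) ∷ cs)) w

    -- A coefficient above n * t pushes the height over the cut-off.
    supported : Supported N X
    supported a b (inj₁ N<a) = total-0 N _ w λ cs →
      slice-supported t {e = ij} {cs = (ij , a) ∷ (jk , b) ∷ cs} (here refl) N<a
    supported a b (inj₂ N<b) = total-0 N _ w λ cs →
      slice-supported t {e = jk} {cs = (ij , a) ∷ (jk , b) ∷ cs} (there (here refl)) N<b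

-- Lattice points of alternating graphs

sum-δ : ∀ {m} (x : Fin m) c → sum (λ y → δ x y * c) ≡ c
sum-δ {suc m} zero    c = trans (cong₂ _+_ (ℕ.*-identityˡ c) (sum-replicate-zero m)) (ℕ.+-identityʳ c)
sum-δ {suc m} (suc x) c = sum-δ x c

sum-out : (cs : Combination n) → sum (λ x → out x cs) ≡ multiplicity cs
sum-out {n} []             = sum-replicate-zero (suc n)
sum-out     ((e , c) ∷ cs) = trans (∑-distrib-+ (λ x → δ (src e) x * c) (λ x → out x cs))
  (cong₂ _+_ (sum-δ (src e) c) (sum-out cs))

-- No vertex of an alternating graph has both outgoing and incoming edges.
positive-alternating : (cs : Combination n) → Alternating (map proj₁ cs) → positive cs ≡ multiplicity cs
positive-alternating cs alt = trans (sum-cong-≗ no-into) (sum-out cs)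
  where
  no-into : ∀ x → out x cs ∸ into x cs ≡ out x cs
  no-into x with any? (arc? (map proj₁ cs) x)
  ... | yes (y , a) = cong (out x cs ∸_) (weighted-0 _ cs (All.tabulate λ {e} e∈ →
    δ-≢ (tgt e) x λ { refl → alt _ _ _ (arc⁺ {e = e} e∈) a }))
  ... | no ¬a rewrite weighted-0 (λ e → δ (src e) x) cs (All.tabulate λ {e} e∈ →
    δ-≢ (src e) x λ { refl → ¬a (_ , arc⁺ {e = e} e∈) }) = ℕ.0∸n≡0 (into x cs)

height-≤ : (cs : Combination n) → height cs ℕ.≤ n * multiplicity cs
height-≤     []             = z≤n
height-≤ {n} ((e , c) ∷ cs) = ℕ.≤-trans
  (ℕ.+-mono-≤ (ℕ.*-monoˡ-≤ c (ℕ.≤-trans (ℕ.m∸n≤m _ (toℕ (src e))) (toℕ≤pred[n] (tgt e)))) (height-≤ cs))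
  (ℕ.≤-reflexive (sym (ℕ.*-distribˡ-+ n c _)))

-- If the multiplicity is t, then `height-≤` shows that the cut-off n * t is respected.
slice-alternating : ∀ t (cs : Combination n) → Alternating (map proj₁ cs) →
                    slice t cs ≡ indicator (multiplicity cs ≡ᵇ t)
slice-alternating {n} t cs alt rewrite positive-alternating cs alt
  with multiplicity cs ≡ᵇ t | ℕ.≡ᵇ⇒≡ (multiplicity cs) t
... | false | _ = refl
... | true  | eq with refl ← eq tt
  rewrite Equivalence.to T-≡ (ℕ.≤⇒≤ᵇ (height-≤ cs)) = refl

-- On generating functions, multiplication by 1/(1 - x) and by x.
prefixSum shift : (ℕ → ℕ) → ℕ → ℕ
prefixSum g t       = sumTo t (λ c → g (t ∸ c))
shift     g zero    = 0
shift     g (suc t) = g t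

ways : FlaggedWord n → ℕ → ℕ
ways []                = λ t → indicator (0 ≡ᵇ t)
ways ((_ , false) ∷ w) = prefixSum (ways w)
ways ((_ , true)  ∷ w) = shift (prefixSum (ways w))

+-≡ᵇ : ∀ c m r → (c + m ≡ᵇ c + r) ≡ (m ≡ᵇ r)
+-≡ᵇ zero    m r = refl
+-≡ᵇ (suc c) m r = +-≡ᵇ c m r

>-≡ᵇ : ∀ {c r} m → r ℕ.< c → (c + m ≡ᵇ r) ≡ false
>-≡ᵇ {suc c} {zero}  m _         = refl
>-≡ᵇ {suc c} {suc r} m (s≤s r<c) = >-≡ᵇ m r<c

total-ways : ∀ {H r} → r ℕ.≤ H → (w : FlaggedWord n) →
             total H (λ cs → indicator (multiplicity cs ≡ᵇ r)) w ≡ ways w r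
total-ways {H = H} {r} r≤H []            = refl
total-ways {H = H} {r} r≤H ((e , σ) ∷ w) = trans
  (sumTo-restrict r≤H
    (λ c c≤r → cong (allowed σ c *_) (trans
      (total-cong H w λ cs _ → cong indicator (trans
        (cong (c + multiplicity cs ≡ᵇ_) (sym (ℕ.m+[n∸m]≡n c≤r))) (+-≡ᵇ c _ _)))
      (total-ways (ℕ.≤-trans (ℕ.m∸n≤m r c) r≤H) w)))
    (λ c r<c → trans (cong (allowed σ c *_)
      (total-0 H _ w λ cs → cong indicator (>-≡ᵇ (multiplicity cs) r<c))) (ℕ.*-zeroʳ (allowed σ c))))
  (flag σ r)
  where
  flag : ∀ σ r → sumTo r (λ c → allowed σ c * ways w (r ∸ c)) ≡ ways ((e , σ) ∷ w) r
  flag false r       = sumTo-cong r λ c → ℕ.*-identityˡ _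
  flag true  zero    = refl
  flag true  (suc r) = sumTo-cong r λ c → ℕ.*-identityˡ _

-- Weak compositions of t into n parts, with generating function 1/(1 - x)^n.
compositions : ℕ → ℕ → ℕ
compositions zero    t = indicator (0 ≡ᵇ t)
compositions (suc n) t = prefixSum (compositions n) t

shifts : ℕ → (ℕ → ℕ) → ℕ → ℕ
shifts zero    g = g
shifts (suc s) g = shift (shifts s g)

flags : FlaggedWord n → ℕ
flags []                = 0
flags ((_ , false) ∷ w) = flags w
flags ((_ , true)  ∷ w) = suc (flags w)

shift-cong : ∀ {f g : ℕ → ℕ} → f ≗ g → shift f ≗ shift g
shift-cong eq zero    = refl
shift-cong eq (suc t) = eq t

prefixSum-cong : ∀ {f g : ℕ → ℕ} → f ≗ g → prefixSum f ≗ prefixSum g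
prefixSum-cong eq t = sumTo-cong t λ c → eq (t ∸ c)

prefixSum-shift : ∀ g → prefixSum (shift g) ≗ shift (prefixSum g)
prefixSum-shift g zero          = refl
prefixSum-shift g (suc zero)    = ℕ.+-identityʳ (g 0)
prefixSum-shift g (suc (suc t)) = cong (g (suc t) +_) (prefixSum-shift g (suc t))

prefixSum-shifts : ∀ s g → prefixSum (shifts s g) ≗ shifts s (prefixSum g)
prefixSum-shifts zero    g t = refl
prefixSum-shifts (suc s) g t =
  trans (prefixSum-shift (shifts s g) t) (shift-cong (prefixSum-shifts s g) t)

-- The factors x of the flagged edges are pulled out past the factors 1/(1 - x).
ways-shifts : (w : FlaggedWord n) → ways w ≗ shifts (flags w) (compositions (length w))
ways-shifts []                t = refl
ways-shifts ((_ , false) ∷ w) t =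
  trans (prefixSum-cong (ways-shifts w) t) (prefixSum-shifts (flags w) _ t)
ways-shifts ((_ , true)  ∷ w) t = shift-cong (λ t →
  trans (prefixSum-cong (ways-shifts w) t) (prefixSum-shifts (flags w) _ t)) t

flags-≤ : (w : FlaggedWord n) → flags w ℕ.≤ length w
flags-≤ []                = z≤n
flags-≤ ((_ , false) ∷ w) = ℕ.≤-trans (flags-≤ w) (ℕ.n≤1+n _)
flags-≤ ((_ , true)  ∷ w) = s≤s (flags-≤ w)

prefixSum-injective : ∀ {f g : ℕ → ℕ} → prefixSum f ≗ prefixSum g → f ≗ g
prefixSum-injective eq zero = eq 0
prefixSum-injective {f} {g} eq (suc t) =
  ℕ.+-cancelʳ-≡ (prefixSum f t) _ _ (trans (eq (suc t)) (cong (g (suc t) +_) (sym (eq t))))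

shiftedSum : ℕ → List ℕ → ℕ → ℕ
shiftedSum m ss t = sumᴸ (map (λ s → shifts s (compositions m) t) ss)

shiftedSum-suc : ∀ m ss → shiftedSum (suc m) ss ≗ prefixSum (shiftedSum m ss)
shiftedSum-suc m []       t = sym (sumTo-0 t)
shiftedSum-suc m (s ∷ ss) t = trans
  (cong₂ _+_ (sym (prefixSum-shifts s _ t)) (shiftedSum-suc m ss t))
  (sym (sumTo-+ t _ _))

compositions-1 : ∀ t → compositions 1 t ≡ 1
compositions-1 zero    = refl
compositions-1 (suc t) = compositions-1 t

shiftedSum-1 : ∀ {N} ss → All (ℕ._≤ N) ss → shiftedSum 1 ss N ≡ length ss
shiftedSum-1     []       []       = refl
shiftedSum-1 {N} (s ∷ ss) (p ∷ ps) = cong₂ _+_ (shifted p) (shiftedSum-1 ss ps)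
  where
  shifted : ∀ {s N} → s ℕ.≤ N → shifts s (compositions 1) N ≡ 1
  shifted {N = N} z≤n = compositions-1 N
  shifted (s≤s p)     = shifted p

-- Taking differences cancels the factors 1/(1 - x) one by one. From m = 0 a summation leads to m =
-- 1, where each summand has value 1 at N because s ≤ N, so the sum counts the summands.
shiftedSum-length : ∀ m {N} ss ss′ → All (ℕ._≤ N) ss → All (ℕ._≤ N) ss′ →
                    shiftedSum m ss ≗ shiftedSum m ss′ → length ss ≡ length ss′
shiftedSum-length zero {N} ss ss′ p p′ eq = begin
  length ss                      ≡⟨ shiftedSum-1 ss p ⟨
  shiftedSum 1 ss N              ≡⟨ shiftedSum-suc 0 ss N ⟩
  prefixSum (shiftedSum 0 ss) N  ≡⟨ prefixSum-cong eq N ⟩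
  prefixSum (shiftedSum 0 ss′) N ≡⟨ shiftedSum-suc 0 ss′ N ⟨
  shiftedSum 1 ss′ N             ≡⟨ shiftedSum-1 ss′ p′ ⟩
  length ss′                     ∎
  where open ≡-Reasoning
shiftedSum-length (suc m) ss ss′ p p′ eq = shiftedSum-length m ss ss′ p p′
  (prefixSum-injective λ t →
    trans (sym (shiftedSum-suc m ss t)) (trans (eq t) (shiftedSum-suc m ss′ t)))

-- The number of leaves

_over_ : FlaggedWord n → Word n → Set
fw over w = map proj₁ fw ↭ w

slices : ℕ → List (FlaggedWord n) → ℕ
slices {n} t fws = sumᴸ (map (total (n * t) (slice t)) fws)

-- Half-open cones of the words vs can be partitioned into such cones of the words ws.
_⇛_ : List (Word n) → List (Word n) → Set
vs ⇛ ws = ∀ fvs → Pointwise _over_ fvs vs →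
  ∃[ fws ] Pointwise _over_ fws ws × (∀ t → slices t fvs ≡ slices t fws)

⇛-refl : (ws : List (Word n)) → ws ⇛ ws
⇛-refl ws fws p = fws , p , λ _ → refl

⇛-trans : {us vs ws : List (Word n)} → us ⇛ vs → vs ⇛ ws → us ⇛ ws
⇛-trans r s fus p =
  let fvs , q , eq = r fus p ; fws , q′ , eq′ = s fvs q in fws , q′ , λ t → trans (eq t) (eq′ t)

⇛-++ : {u : Word n} {us ws vs : List (Word n)} → [ u ] ⇛ us → vs ⇛ ws → (u ∷ vs) ⇛ (us ++ ws)
⇛-++ r s (fu ∷ fvs) (p ∷ ps) =
  let fus , q , eq = r [ fu ] (p ∷ []) ; fws , q′ , eq′ = s fvs ps in
  fus ++ fws , Pointwise.++⁺ q q′ , λ t → begin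
    total _ (slice t) fu + slices t fvs       ≡⟨ cong₂ _+_ (trans (sym (ℕ.+-identityʳ _)) (eq t)) (eq′ t) ⟩
    slices t fus + slices t fws               ≡⟨ ListAction.sum-++ (map _ fus) _ ⟨
    sumᴸ (map _ fus ++ map _ fws)             ≡⟨ cong sumᴸ (map-++ _ fus fws) ⟨
    slices t (fus ++ fws)                     ∎
  where open ≡-Reasoning

⇛-reduce : ∀ {w w₁ w₂ R : Word n} {i j k : Vertex n} .(i<j : i < j) .(j<k : j < k) →
  let ij = edge i j i<j
      jk = edge j k j<k
      ik = edge i k (Fin.<-trans i<j j<k)
  in w ↭ ij ∷ jk ∷ R → ik ∷ ij ∷ R ↭ w₁ → jk ∷ ik ∷ R ↭ w₂ → [ w ] ⇛ (w₁ ∷ w₂ ∷ [])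
⇛-reduce {n} i<j j<k p p₁ p₂ (fw ∷ []) (q ∷ [])
  with (_ , σ) ∷ (_ , σ′) ∷ fR , refl , r ← ↭.↭-map-inv proj₁ (↭-trans q p) =
  fw₁ σ′ (tie σ σ′) fR ∷ fw₂ (not (tie σ σ′)) σ fR ∷ [] , p₁ ∷ p₂ ∷ [] , λ t →
  let Φ = total (n * t) (slice t) in
  trans (cong (_+ 0) (trans (total-↭ (n * t) (slice-symmetrical t) r) (total-reduce i<j j<k t σ σ′ fR)))
    (ℕ.+-assoc (Φ (fw₁ σ′ (tie σ σ′) fR)) (Φ (fw₂ (not (tie σ σ′)) σ fR)) 0)
  where
  fw₁ fw₂ : Bool → Bool → FlaggedWord n → FlaggedWord n
  fw₁ σ τ fR = (edge _ _ (Fin.<-trans i<j j<k) , σ) ∷ (edge _ _ i<j , τ) ∷ fR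
  fw₂ τ σ fR = (edge _ _ j<k , τ) ∷ (edge _ _ (Fin.<-trans i<j j<k) , σ) ∷ fR

record Leaf (w : Word n) : Set where
  constructor leaf
  field
    alternating : Alternating w
    edges       : length w ≡ n

slice-leaf : 1 ℕ.≤ n → ∀ {fw : FlaggedWord n} {w} → fw over w → Leaf w →
             (∀ t → total (n * t) (slice t) fw ≡ shifts (flags fw) (compositions n) t) × flags fw ℕ.≤ n
slice-leaf {n} 1≤n {fw} {w} p (leaf alt len) =
  (λ t → trans
    (total-cong (n * t) fw λ cs eq → slice-alternating t cs (alt-fw eq))
    -- Since 1 ≤ n, the cap n * t is at least t and cuts off no coefficient vector of sum t.
    (trans (total-ways (ℕ.m≤n*m t n {{ℕ.>-nonZero 1≤n}}) fw)
      (trans (ways-shifts fw t) (cong (λ m → shifts (flags fw) (compositions m) t) length-fw)))) ,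
  subst (flags fw ℕ.≤_) length-fw (flags-≤ fw)
  where
  length-fw : length fw ≡ n
  length-fw = trans (sym (length-map proj₁ fw)) (trans (↭.↭-length p) len)

  alt-fw : ∀ {v} → v ≡ map proj₁ fw → Alternating v
  alt-fw refl i j k a b = alt i j k (arc-mono (↭.∈-resp-↭ p) a) (arc-mono (↭.∈-resp-↭ p) b)

slices-leaves : 1 ℕ.≤ n → ∀ {fws : List (FlaggedWord n)} {ws} → Pointwise _over_ fws ws → All Leaf ws →
                (∀ t → slices t fws ≡ shiftedSum n (map flags fws) t) × All (ℕ._≤ n) (map flags fws)
slices-leaves 1≤n []       []       = (λ _ → refl) , []
slices-leaves 1≤n (p ∷ ps) (l ∷ ls) =
  let eq , le = slice-leaf 1≤n p l ; eqs , les = slices-leaves 1≤n ps ls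
  in (λ t → cong₂ _+_ (eq t) (eqs t)) , le ∷ les

-- Both lists of leaves partition the closed cones of `vs`. Each leaf contributes x^s / (1 - x)^n
-- for some s ≤ n, and the two sums agree.
⇛-leaves : 1 ℕ.≤ n → ∀ {vs ws ws′ : List (Word n)} → vs ⇛ ws → vs ⇛ ws′ →
           All Leaf ws → All Leaf ws′ → length ws ≡ length ws′
⇛-leaves {n} 1≤n {vs} {ws} {ws′} r r′ ls ls′ =
  let p : Pointwise _over_ (map unflagged vs) vs
      p = unflagged-over vs
      fws , q , eq = r _ p
      fws′ , q′ , eq′ = r′ _ p
      sums , bounds = slices-leaves 1≤n q ls
      sums′ , bounds′ = slices-leaves 1≤n q′ ls′
  in begin
    length ws               ≡⟨ Pointwise.Pointwise-length q ⟨
    length fws              ≡⟨ length-map flags fws ⟨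
    length (map flags fws)  ≡⟨ shiftedSum-length n _ _ bounds bounds′ (λ t →
                                 trans (sym (sums t)) (trans (sym (eq t)) (trans (eq′ t) (sums′ t)))) ⟩
    length (map flags fws′) ≡⟨ length-map flags fws′ ⟩
    length fws′             ≡⟨ Pointwise.Pointwise-length q′ ⟩
    length ws′              ∎
  where
  open ≡-Reasoning

  unflagged : Word n → FlaggedWord n
  unflagged = map (_, false)

  unflagged-over : ∀ vs → Pointwise _over_ (map unflagged vs) vs
  unflagged-over []       = []
  unflagged-over (v ∷ vs) = ↭.↭-reflexive (trans (sym (map-∘ v)) (map-id v)) ∷ unflagged-over vs

-- A partition with f_T leaves

+-left-swap : ∀ a b c → a + (b + c) ≡ b + (a + c)
+-left-swap = solve 3 (λ a b c → a :+ (b :+ c) := b :+ (a :+ c)) refl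

-- The termination measure: a reduction replaces one edge by a longer one, and lengths are at most
-- n.
edgeSlack : Edge n → ℕ
edgeSlack {n} e = n ∸ (toℕ (tgt e) ∸ toℕ (src e))

slack : Graph n → ℕ
slack G = sumᴸ (map edgeSlack G)

slack-↭ : {G H : Graph n} → G ↭ H → slack G ≡ slack H
slack-↭ p = ListAction.sum-↭ (↭.map⁺ edgeSlack p)

-- Only the partition of cones is recorded, as this is all that `⇛-leaves` compares.
record Leaves (T : Graph n) : Set where
  constructor mkLeaves
  field
    words   : List (Word n)
    reduces : [ T ] ⇛ words
    number  : length words ≡ f[ T ]
    isLeaf  : All Leaf words

Leaves-reduce : ∀ {T R : Graph n} {i j k} .(i<j : i < j) .(j<k : j < k) →
  let open NoncrossingReduction i j k i<j j<k R renaming (T to T₀) in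
  T ↭ T₀ → f[ T₀ ] ≡ f[ T₁ ] + f[ T₂ ] → Leaves T₁ → Leaves T₂ → Leaves T
Leaves-reduce {T = T} {R} {i} {j} {k} i<j j<k perm eq (mkLeaves ws₁ r₁ len₁ ls₁) (mkLeaves ws₂ r₂ len₂ ls₂) = mkLeaves
  (ws₁ ++ ws₂)
  (⇛-trans (⇛-reduce i<j j<k perm ↭.refl ↭.refl)
    (⇛-++ r₁ (subst ([ N.T₂ ] ⇛_) (++-identityʳ ws₂) (⇛-++ r₂ (⇛-refl [])))))
  (trans (length-++ ws₁) (trans (cong₂ _+_ len₁ len₂) (trans (sym eq) (sym (f-↭ perm)))))
  (All.++⁺ ls₁ ls₂)
  where module N = NoncrossingReduction i j k i<j j<k R

leaves : (T : Graph n) → NoncrossingTree T → Acc ℕ._<_ (slack T) → Leaves T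
leaves {n} T tree (acc smaller) with alternating-or-pair T
... | inj₁ alt =
  mkLeaves [ T ] (⇛-refl [ T ]) (sym (f-alternating tree alt)) (leaf alt (NoncrossingTree.edges tree) ∷ [])
... | inj₂ pair with R , perm ← extract-pair (arc-< (LongestPair.ij pair)) (arc-< (LongestPair.jk pair))
                                  (LongestPair.ij pair) (LongestPair.jk pair) =
  Leaves-reduce i<j j<k perm (N.f-reduce tree′ i-min′ k-max′)
    (leaves N.T₁ (N.tree₁ tree′ i-min′ k-max′) (smaller slack₁))
    (leaves N.T₂ (N.tree₂ tree′ i-min′ k-max′) (smaller slack₂))
  where
  open LongestPair pair
  i<j = arc-< ij
  j<k = arc-< jk

  module N = NoncrossingReduction i j k i<j j<k R

  tree′ : NoncrossingTree N.T
  tree′ = NoncrossingTree-resp-↭ perm tree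

  i-min′ : ∀ {m} → Arc N.T m j → i ≤ m
  i-min′ a = i-min (arc-mono (↭.∈-resp-↭ (↭-sym perm)) a)

  k-max′ : ∀ {l} → Arc N.T j l → l ≤ k
  k-max′ a = k-max (arc-mono (↭.∈-resp-↭ (↭-sym perm)) a)

  -- As `ik` has length at most n, truncated subtraction stays strict.
  long : ∀ {l} → l ℕ.< toℕ k ∸ toℕ i → edgeSlack N.ik ℕ.< n ∸ l
  long l< = ℕ.∸-monoʳ-< l< (ℕ.≤-trans (ℕ.m∸n≤m (toℕ k) (toℕ i)) (toℕ≤pred[n] k))

  slack-T : slack T ≡ edgeSlack N.jk + (edgeSlack N.ij + slack R)
  slack-T = trans (slack-↭ perm) (+-left-swap (edgeSlack N.ij) (edgeSlack N.jk) (slack R))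

  slack₁ : slack N.T₁ ℕ.< slack T
  slack₁ = subst (slack N.T₁ ℕ.<_) (sym slack-T) (ℕ.+-monoˡ-< (edgeSlack N.ij + slack R)
    (long (ℕ.∸-monoʳ-< i<j (ℕ.<⇒≤ j<k))))

  slack₂ : slack N.T₂ ℕ.< slack T
  slack₂ = subst (slack N.T₂ ℕ.<_) (sym slack-T) (ℕ.+-monoʳ-< (edgeSlack N.jk)
    (ℕ.+-monoˡ-< (slack R) (long (ℕ.∸-monoˡ-< j<k (ℕ.<⇒≤ i<j)))))

-- Commutative reduced forms

module _ {n : ℕ} where
  open 𝒮 {n} using (_∼_; Reduce; IsReducedForm; Swap)
  open Words {n} AnyCommute

  ↭⇒∼ : {v w : Word n} → v ↭ w → v ∼ w
  ↭⇒∼ ↭.refl         = ε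
  ↭⇒∼ (↭.prep e p)   = ∼-cons e (↭⇒∼ p)
  ↭⇒∼ (↭.swap e f p) = Eq.return (𝒮.here tt) ◅◅ ∼-cons f (∼-cons e (↭⇒∼ p))
  ↭⇒∼ (↭.trans p q)  = ↭⇒∼ p ◅◅ ↭⇒∼ q

  ↦⇒⇛ : {w : Word n} {ws : List (Word n)} → w ↦ ws → [ w ] ⇛ ws
  ↦⇒⇛ (reduce u v i<j j<k s) = ⇛-reduce i<j j<k
    (↭-trans (∼⇒↭ s) (↭.shifts u (_ ∷ _ ∷ [])))
    (↭-sym (↭.shifts u (_ ∷ _ ∷ []))) (↭-sym (↭.shifts u (_ ∷ _ ∷ [])))

  ↦-length : ∀ {m} {w : Word n} {ws : List (Word n)} → w ↦ ws → length w ≡ m → All (λ v → length v ≡ m) ws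
  ↦-length (reduce u v i<j j<k s) len =
    trans (lengths _ _ _ _) len′ ∷ trans (lengths _ _ _ _) len′ ∷ []
    where
    len′ = trans (sym (↭.↭-length (∼⇒↭ s))) len
    lengths : ∀ a b c d → length (u ++ a ∷ b ∷ v) ≡ length (u ++ c ∷ d ∷ v)
    lengths a b c d = trans (length-++ u) (sym (length-++ u))

  ⟶⇒⇛ : {vs ws : List (Word n)} → vs ⟶ ws → vs ⇛ ws
  ⟶⇒⇛ stop = ⇛-refl _
  ⟶⇒⇛ (here {ws = ws} r) = ⇛-++ (↦⇒⇛ r) (⇛-refl ws)
  ⟶⇒⇛ (there {w = w} s) = ⇛-++ (⇛-refl [ w ]) (⟶⇒⇛ s)

  ⟶-length : ∀ {m} {vs ws : List (Word n)} → vs ⟶ ws →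
              All (λ v → length v ≡ m) vs → All (λ v → length v ≡ m) ws
  ⟶-length stop      ls       = ls
  ⟶-length (here r)  (l ∷ ls) = All.++⁺ (↦-length r l) ls
  ⟶-length (there s) (l ∷ ls) = l ∷ ⟶-length s ls

  reductions : ∀ {m} {P Q : Poly n} → Star Reduce P Q → All (λ v → length v ≡ m) (zeros P) →
               zeros P ⇛ zeros Q × All (λ v → length v ≡ m) (zeros Q)
  reductions ε        ls = ⇛-refl _ , ls
  reductions (r ◅ rs) ls =
    let s = reduce-zeros r
        t , ls′ = reductions rs (⟶-length s ls)
    in ⇛-trans (⟶⇒⇛ s) t , ls′

  irreducible⇒alternating : {w : Word n} → ¬ ∃ (w ↦_) → Alternating w
  irreducible⇒alternating irr i j k a b with R , perm ← extract-pair (arc-< a) (arc-< b) a b =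
    irr (_ , reduce [] R (arc-< a) (arc-< b) (↭⇒∼ perm))

  eval-zeros : (P : Poly n) → eval (λ _ → 1) 0 P ≡ length (zeros P)
  eval-zeros []                = refl
  eval-zeros ((zero  , w) ∷ P) = cong₂ _+_ (trans (ℕ.+-identityʳ _) (product-1 w)) (eval-zeros P)
    where
    product-1 : (w : Word n) → product (map (λ _ → 1) w) ≡ 1
    product-1 []      = refl
    product-1 (e ∷ w) = trans (ℕ.+-identityʳ _) (product-1 w)
  eval-zeros ((suc _ , w) ∷ P) = eval-zeros P

  -- The value is the number of words in `zeros P`. These are leaves of a partition of the cones of
  -- `T`, hence as many as the f_T leaves found by `leaves`.
  commutative : 1 ℕ.≤ n → (T : Graph n) → IsTree T → Noncrossing T →
                (P : Poly n) → IsReducedForm (monomial T) P → eval (λ _ → 1) 0 P ≡ f[ T ]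
  commutative 1≤n T tree nc P (steps , irr) =
    let r , lengths = reductions steps (tree-length tree ∷ [])
        mkLeaves ws s len ls = leaves T (record { noncrossing = nc ; connected = proj₂ tree
                                             ; edges = tree-length tree }) (<-wellFounded _)
    in trans (eval-zeros P) (trans (⇛-leaves 1≤n r s
         (All.zipWith (λ (irr , l) → leaf (irreducible⇒alternating irr) l)
           (irreducible-zeros P irr , lengths)) ls) len)

theorem2 : (n : ℕ) → 1 ℕ.≤ n → (T : Graph n) → IsTree T → Noncrossing T →
    ((P : Poly n) → 𝒮.IsReducedForm (monomial T) P → eval (λ _ → 1) 0 P ≡ f[ T ])
    × ((L : Graph n) → L ↭ T → IsGoodTree L →
    (P : Poly n) → ℬ.IsReducedForm (monomial L) P → P [β≔ 0 ] ℬ.≈ ∑nasts T)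
theorem2 n 1≤n T tree nc =
  commutative 1≤n T tree nc , λ L L↭T good P reduced → noncommutative L↭T good P reduced
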